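{- Let $r\ge1$, let $b_1\ge\cdots\ge b_r$ be integers with $b_i\ge i$ for all $i$, and let $x=(i,c)\le y=(j,d)$ be elements of the Ferrers-cell poset $F_{\mathbf b}$. Put $h=(i-j)+(d-c)$. Let $\mathcal W_{\mathbf b}(x,y)$ be the set of words in $\{L,R\}$ with exactly $i-j$ letters $L$ and $d-c$ letters $R$ such that, for every prefix with $L_k$ letters $L$ and $R_k$ letters $R$, $c+R_k\le b_{i-L_k}$. For such a word $w=w_1\cdots w_h$ set $D_{x,y}(w)=\{p\in\{1,\dots,h-1\}:w_p=R,\ w_{p+1}=L\}$. Then, with the induced rank $\rho_{x,y}(z)=\rho(z)-\rho(x)$ on the interval $[x,y]$, $$\mathbb{H}_{[x,y],\rho_{x,y}}(q,t)=\sum_{w\in\mathcal W_{\mathbf b}(x,y)}q^{\sum_{p\in D_{x,y}(w)}p}\,t^{|D_{x,y}(w)|}.$$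
   Context: $q$-Zeta numerator: let $P$ be a finite graded poset with a unique maximum and rank function $\rho:P\to\{0,\dots,H\}$, where $H$ is the maximal rank. For $m\ge 0$ put $A_m(P,\rho;q)=\sum_{x_1\le\cdots\le x_m}q^{\rho(x_1)+\cdots+\rho(x_m)}$ (sum over weak chains in $P$; $A_0=1$). The numerator $\mathbb{H}_{P,\rho}(q,t)$ is the polynomial determined by $\sum_{m\ge 0}A_m(P,\rho;q)t^m=\mathbb{H}_{P,\rho}(q,t)/\prod_{a=0}^{H}(1-q^at)$. Ferrers-cell poset: $F_{\mathbf b}=\{(i,c):1\le i\le r,\ i\le c\le b_i\}$, ordered by $(i,c)\le(j,d)\iff i\ge j$ and $c\le d$, with rank $\rho(i,c)=c-i$. -}

module Defs where

open import Data.Bool.Base using (if_then_else_)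
open import Data.Integer.Base as ℤ using (ℤ; 0ℤ; 1ℤ)
open import Data.List.Base
  using (List; []; _∷_; map; foldr; filter; length; upTo; inits;
         cartesianProduct; cartesianProductWith)
open import Data.List.Extrema.Nat using (max)
import Data.List.Membership.Propositional.Properties as ∈
import Data.List.Membership.Setoid as Membership
open import Data.List.Relation.Unary.All as All using (All; []; _∷_)
open import Data.List.Relation.Unary.AllPairs using ([]; _∷_)
open import Data.List.Relation.Unary.Any using (here; there)
open import Data.List.Relation.Unary.Linked using (Linked; linked?)
import Data.List.Relation.Unary.Unique.Propositional.Properties as Unique
import Data.List.Relation.Unary.Unique.Setoid as UniqueSetoid
open import Data.Nat.Base using (ℕ; zero; suc; _+_; _∸_; _≤_; _<_; s≤s)
open import Data.Nat.ListAction using (sum)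
open import Data.Nat.Properties as ℕ using (_≟_; _≤?_)
open import Data.Product.Base using (Σ; ∃; _×_; _,_; proj₁; proj₂)
open import Data.Product.Properties using (≡-dec)
open import Data.Sum.Base using (_⊎_)
open import Level using (0ℓ)
open import Relation.Binary.Bundles using (DecPoset; Setoid)
import Relation.Binary.Construct.On as On
open import Relation.Binary.Core using (_Preserves_⟶_)
open import Relation.Binary.Definitions using (Maximum; _Respects_)
open import Relation.Binary.PropositionalEquality
  using (_≡_; refl; sym; trans; cong; cong₂; setoid; isEquivalence)
open import Relation.Nullary using (¬_; yes; no; contradiction)
open import Relation.Nullary.Decidable using (does; _×-dec_)
import Relation.Unary as U

-- A formal power series is given by its coefficients: f n is that of qⁿ.
Series-q : Set
Series-q = ℕ → ℤ

-- f m n is the coefficient of tᵐ qⁿ (note the order of the indices).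
Series-qt : Set
Series-qt = ℕ → Series-q

infix 4 _≈ₛ_
_≈ₛ_ : Series-qt → Series-qt → Set
f ≈ₛ g = ∀ m n → f m n ≡ g m n

∑ : {A : Set} → List A → (A → ℤ) → ℤ
∑ xs f = foldr ℤ._+_ 0ℤ (map f xs)

q^_ : ℕ → Series-q
(q^ a) n = if does (a ≟ n) then 1ℤ else 0ℤ

q^_t^_ : ℕ → ℕ → Series-qt
(q^ a t^ k) m n = if does (k ≟ m) then (q^ a) n else 0ℤ

infixl 6 _-ₛ_
_-ₛ_ : Series-qt → Series-qt → Series-qt
(f -ₛ g) m n = f m n ℤ.- g m n

infixl 7 _*ₛ_
_*ₛ_ : Series-qt → Series-qt → Series-qt
(f *ₛ g) m n =
  ∑ (upTo (suc m)) λ k → ∑ (upTo (suc n)) λ l → f k l ℤ.* g (m ∸ k) (n ∸ l)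

IsPolynomial : Series-qt → Set
IsPolynomial f = ∃ λ N → ∀ m n → N ≤ m ⊎ N ≤ n → f m n ≡ 0ℤ

record FinGradedPoset : Set₁ where
  field
    decPoset : DecPoset 0ℓ 0ℓ 0ℓ

  open DecPoset decPoset public renaming (_≤_ to _≤ᴾ_; _≤?_ to _≤ᴾ?_; _≟_ to _≟ᴾ_)
  open Membership Eq.setoid public using (_∈_)

  infix 4 _≺_ _⋖_
  _≺_ : Carrier → Carrier → Set
  x ≺ y = x ≤ᴾ y × ¬ x ≈ y

  _⋖_ : Carrier → Carrier → Set
  x ⋖ y = x ≺ y × (∀ z → ¬ (x ≺ z × z ≺ y))

  field
    elements : List Carrier
    complete : ∀ x → x ∈ elements
    unique   : UniqueSetoid.Unique Eq.setoid elements
    top      : Carrier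
    maximum  : Maximum _≤ᴾ_ top
    rank     : Carrier → ℕ
    rank-cong  : rank Preserves _≈_ ⟶ _≡_
    rank-mono  : rank Preserves _≺_ ⟶ _<_
    rank-cover : ∀ {x y} → x ⋖ y → rank y ≡ suc (rank x)

listsOfLength : {A : Set} → ℕ → List A → List (List A)
listsOfLength zero    xs = [] ∷ []
listsOfLength (suc n) xs = cartesianProductWith _∷_ xs (listsOfLength n xs)

module _ (P : FinGradedPoset) where
  open FinGradedPoset P using (Carrier; _≤ᴾ?_; elements; rank)

  weakChains : ℕ → List (List Carrier)
  weakChains m = filter (linked? _≤ᴾ?_) (listsOfLength m elements)

  A[_] : ℕ → Series-q
  A[ m ] n = ∑ (weakChains m) λ xs → (q^ sum (map rank xs)) n

  -- ∑ₘ A[ m ] tᵐ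
  zetaSeries : Series-qt
  zetaSeries m = A[ m ]

  maxRank : ℕ
  maxRank = max 0 (map rank elements)

  -- ∏ₐ (1 - qᵃ t) over 0 ≤ a ≤ maxRank
  denominator : Series-qt
  denominator =
    foldr _*ₛ_ (q^ 0 t^ 0) (map (λ a → q^ 0 t^ 0 -ₛ q^ a t^ 1) (upTo (suc maxRank)))

  -- The denominator has constant term 1, so zetaSeries = N / denominator is
  -- the same as the product equation below, which determines N.
  IsNumerator : Series-qt → Set
  IsNumerator N = IsPolynomial N × zetaSeries *ₛ denominator ≈ₛ N

  numerator-unique : ∀ {M N} → IsNumerator M → IsNumerator N → M ≈ₛ N
  numerator-unique (_ , eqM) (_ , eqN) m n = trans (sym (eqM m n)) (eqN m n)

module _ {A : Set} {P : A → Set} (P? : U.Decidable P) where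

  restrict : List A → List (Σ A P)
  restrict [] = []
  restrict (x ∷ xs) with P? x
  ... | yes px = (x , px) ∷ restrict xs
  ... | no  _  = restrict xs

module _ (S : Setoid 0ℓ 0ℓ) where
  open Setoid S using (_≈_; Carrier)
  open Membership S using (_∈_)

  private
    variable
      P : Carrier → Set

  Subsetoid : (Carrier → Set) → Setoid 0ℓ 0ℓ
  Subsetoid P = On.setoid S (proj₁ {B = P})

  restrict-complete : (P? : U.Decidable P) → P Respects _≈_ →
    ∀ {xs} z → proj₁ z ∈ xs → Membership._∈_ (Subsetoid P) z (restrict P? xs)
  restrict-complete P? resp {x ∷ xs} (z , pz) z∈ with P? x | z∈
  ... | yes _  | here z≈x  = here z≈x
  ... | yes _  | there z∈′ = there (restrict-complete P? resp (z , pz) z∈′)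
  ... | no ¬px | here z≈x  = contradiction (resp z≈x pz) ¬px
  ... | no _   | there z∈′ = restrict-complete P? resp (z , pz) z∈′

  restrict-all : (P? : U.Decidable P) {Q : Carrier → Set} →
    ∀ {xs} → All Q xs → All (λ z → Q (proj₁ z)) (restrict P? xs)
  restrict-all P? [] = []
  restrict-all P? {xs = x ∷ _} (qx ∷ qxs) with P? x
  ... | yes _ = qx ∷ restrict-all P? qxs
  ... | no  _ = restrict-all P? qxs

  restrict-unique : (P? : U.Decidable P) →
    ∀ {xs} → UniqueSetoid.Unique S xs →
    UniqueSetoid.Unique (Subsetoid P) (restrict P? xs)
  restrict-unique P? [] = []
  restrict-unique P? {x ∷ _} (x∉ ∷ u) with P? x
  ... | yes _ = restrict-all P? x∉ ∷ restrict-unique P? u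
  ... | no  _ = restrict-unique P? u

module _ (P : FinGradedPoset) where
  open FinGradedPoset P using (Carrier; rank; _≤ᴾ_; _≤ᴾ?_; _≟ᴾ_)
  private module P = FinGradedPoset P

  Between : Carrier → Carrier → Carrier → Set
  Between x y z = x ≤ᴾ z × z ≤ᴾ y

  between? : ∀ x y → U.Decidable (Between x y)
  between? x y z = (x ≤ᴾ? z) ×-dec (z ≤ᴾ? y)

  rank-mono-≤ : ∀ {u v} → u ≤ᴾ v → rank u ≤ rank v
  rank-mono-≤ {u} {v} u≤v with u ≟ᴾ v
  ... | yes u≈v = ℕ.≤-reflexive (P.rank-cong u≈v)
  ... | no  u≉v = ℕ.<⇒≤ (P.rank-mono (u≤v , u≉v))

  interval : ∀ {x y} → x ≤ᴾ y → FinGradedPoset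
  interval {x} {y} x≤y = record
    { decPoset   = On.decPoset P.decPoset (proj₁ {B = Between x y})
    ; elements   = restrict (between? x y) P.elements
    ; complete   = λ z → restrict-complete P.Eq.setoid (between? x y) resp z
                           (P.complete (proj₁ z))
    ; unique     = restrict-unique P.Eq.setoid (between? x y) P.unique
    ; top        = y , x≤y , P.refl
    ; maximum    = λ z → proj₂ (proj₂ z)
    ; rank       = λ z → rank (proj₁ z) ∸ rank x
    ; rank-cong  = λ u≈v → cong (_∸ rank x) (P.rank-cong u≈v)
    ; rank-mono  = λ {u} u≺v →
        ℕ.∸-monoˡ-< (P.rank-mono u≺v) (rank-mono-≤ (proj₁ (proj₂ u)))
    ; rank-cover = λ {u} {v} → cover u v
    }
    where
    resp : Between x y Respects P._≈_
    resp u≈v (x≤u , u≤y) =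
      P.trans x≤u (P.reflexive u≈v) , P.trans (P.reflexive (P.Eq.sym u≈v)) u≤y

    cover : (u v : Σ Carrier (Between x y)) →
      (proj₁ u P.≺ proj₁ v) ×
        ((w : Σ Carrier (Between x y)) →
          ¬ (proj₁ u P.≺ proj₁ w × proj₁ w P.≺ proj₁ v)) →
      rank (proj₁ v) ∸ rank x ≡ suc (rank (proj₁ u) ∸ rank x)
    cover (u , x≤u , u≤y) (v , x≤v , v≤y) (u≺v , none) = trans
      (cong (_∸ rank x) (P.rank-cover (u≺v , λ w (u≺w , w≺v) →
        none (w , P.trans x≤u (proj₁ u≺w) , P.trans (proj₁ w≺v) v≤y)
             (u≺w , w≺v))))
      (ℕ.+-∸-assoc 1 (rank-mono-≤ x≤u))

-- Rows are numbered from 1; only the values b 1, …, b r are relevant.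
IsCell : (r : ℕ) (b : ℕ → ℕ) → ℕ × ℕ → Set
IsCell r b (i , c) = (1 ≤ i × i ≤ r) × (i ≤ c × c ≤ b i)

Cell : (r : ℕ) (b : ℕ → ℕ) → Set
Cell r b = Σ (ℕ × ℕ) (IsCell r b)

infix 4 _⊑_
_⊑_ : ℕ × ℕ → ℕ × ℕ → Set
(i , c) ⊑ (j , d) = j ≤ i × c ≤ d

cellRank : ℕ × ℕ → ℕ
cellRank (i , c) = c ∸ i

isCell? : ∀ r b → U.Decidable (IsCell r b)
isCell? r b (i , c) = ((1 ≤? i) ×-dec (i ≤? r)) ×-dec ((i ≤? c) ×-dec (c ≤? b i))

⊑-decPoset : DecPoset 0ℓ 0ℓ 0ℓ
⊑-decPoset = record
  { Carrier = ℕ × ℕ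
  ; _≈_     = _≡_
  ; _≤_     = _⊑_
  ; isDecPartialOrder = record
    { isPartialOrder = record
      { isPreorder = record
        { isEquivalence = isEquivalence
        ; reflexive     = λ { refl → ℕ.≤-refl , ℕ.≤-refl }
        ; trans         = λ (p , q) (p′ , q′) → ℕ.≤-trans p′ p , ℕ.≤-trans q q′
        }
      ; antisym = λ (p , q) (p′ , q′) → cong₂ _,_ (ℕ.≤-antisym p′ p) (ℕ.≤-antisym q q′)
      }
    ; _≟_  = ≡-dec _≟_ _≟_
    ; _≤?_ = λ (i , c) (j , d) → (j ≤? i) ×-dec (c ≤? d)
    }
  }

grid : (r : ℕ) (b : ℕ → ℕ) → List (ℕ × ℕ)
grid r b = cartesianProduct (upTo (suc r)) (upTo (suc (b 1)))

cells : (r : ℕ) (b : ℕ → ℕ) → List (Cell r b)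
cells r b = restrict (isCell? r b) (grid r b)

module _ (r : ℕ) (b : ℕ → ℕ) (1≤r : 1 ≤ r)
         (b-anti  : ∀ i j → 1 ≤ i → i ≤ j → j ≤ r → b j ≤ b i)
         (b-above : ∀ i → 1 ≤ i → i ≤ r → i ≤ b i) where

  private
    in-grid : (x : Cell r b) → Membership._∈_ (setoid _) (proj₁ x) (grid r b)
    in-grid ((i , c) , (1≤i , i≤r) , _ , c≤bi) =
      ∈.∈-cartesianProduct⁺ (∈.∈-upTo⁺ (s≤s i≤r))
        (∈.∈-upTo⁺ (s≤s (ℕ.≤-trans c≤bi (b-anti 1 i ℕ.≤-refl 1≤i i≤r))))

    mono : (x y : Cell r b) → proj₁ x ⊑ proj₁ y → ¬ proj₁ x ≡ proj₁ y → cellRank (proj₁ x) < cellRank (proj₁ y)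
    mono ((i , c) , _ , i≤c , _) ((j , d) , _) (j≤i , c≤d) x≢y with j ≟ i
    ... | yes refl = ℕ.∸-monoˡ-< (ℕ.≤∧≢⇒< c≤d λ { refl → x≢y refl }) i≤c
    ... | no  j≢i  = ℕ.<-≤-trans
      (ℕ.∸-monoʳ-< (ℕ.≤∧≢⇒< j≤i j≢i) i≤c) (ℕ.∸-monoˡ-≤ j c≤d)

    cover : (x y : Cell r b) → proj₁ x ⊑ proj₁ y × ¬ proj₁ x ≡ proj₁ y →
      ((z : Cell r b) → ¬ ((proj₁ x ⊑ proj₁ z × ¬ proj₁ x ≡ proj₁ z) ×
                           (proj₁ z ⊑ proj₁ y × ¬ proj₁ z ≡ proj₁ y))) →
      cellRank (proj₁ y) ≡ suc (cellRank (proj₁ x))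
    cover ((i , c) , (1≤i , i≤r) , i≤c , c≤bi) ((j , d) , (1≤j , j≤r) , j≤d , d≤bj)
          ((j≤i , c≤d) , x≢y) none with j ≟ i
    cover ((i , c) , (1≤i , i≤r) , i≤c , c≤bi) ((j , d) , (1≤j , j≤r) , j≤d , d≤bj)
          ((j≤i , c≤d) , x≢y) none | yes refl
      with ≡-dec _≟_ _≟_ (j , suc c) (j , d)
    ... | yes refl = ℕ.+-∸-assoc 1 i≤c
    ... | no  z≢y  = contradiction
      ( ((ℕ.≤-refl , ℕ.n≤1+n c) , λ ())
      , ((ℕ.≤-refl , c<d) , z≢y) )
      (none ((j , suc c) , (1≤j , j≤r) , ℕ.m≤n⇒m≤1+n i≤c , ℕ.≤-trans c<d d≤bj))
      where
      c<d : c < d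
      c<d = ℕ.≤∧≢⇒< c≤d λ { refl → x≢y refl }
    cover ((suc i , c) , (1≤i , i≤r) , i≤c , c≤bi) ((j , d) , (1≤j , j≤r) , j≤d , d≤bj)
          ((j≤i , c≤d) , x≢y) none | no j≢i
      with ≡-dec _≟_ _≟_ (i , c) (j , d)
    ... | yes refl = ℕ.+-∸-assoc 1 i≤c
    ... | no  z≢y  = contradiction
      ( ((ℕ.n≤1+n i , ℕ.≤-refl) , λ e → ℕ.1+n≢n (cong proj₁ e))
      , ((j≤i′ , c≤d) , z≢y) )
      (none ((i , c) , (1≤i′ , i≤r′) , ℕ.≤-trans (ℕ.n≤1+n i) i≤c
            , ℕ.≤-trans c≤bi (b-anti i (suc i) 1≤i′ (ℕ.n≤1+n i) i≤r)))
      where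
      j≤i′ : j ≤ i
      j≤i′ = ℕ.≤-pred (ℕ.≤∧≢⇒< j≤i j≢i)
      1≤i′ : 1 ≤ i
      1≤i′ = ℕ.≤-trans 1≤j j≤i′
      i≤r′ : i ≤ r
      i≤r′ = ℕ.≤-trans (ℕ.n≤1+n i) i≤r

  ferrersPoset : FinGradedPoset
  ferrersPoset = record
    { decPoset   = On.decPoset ⊑-decPoset (proj₁ {B = IsCell r b})
    ; elements   = cells r b
    ; complete   = λ x → restrict-complete (setoid _) (isCell? r b)
                           (λ { refl p → p }) x (in-grid x)
    ; unique     = restrict-unique (setoid _) (isCell? r b)
                     (Unique.cartesianProduct⁺
                       (Unique.upTo⁺ (suc r)) (Unique.upTo⁺ (suc (b 1))))
    ; top        = (1 , b 1) , (ℕ.≤-refl , 1≤r) , b-above 1 ℕ.≤-refl 1≤r , ℕ.≤-refl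
    ; maximum    = λ (_ , (1≤i , i≤r) , _ , c≤bi) →
                     1≤i , ℕ.≤-trans c≤bi (b-anti 1 _ ℕ.≤-refl 1≤i i≤r)
    ; rank       = λ x → cellRank (proj₁ x)
    ; rank-cong  = λ x≡y → cong cellRank x≡y
    ; rank-mono  = λ {x} {y} (x≤y , x≢y) → mono x y x≤y x≢y
    ; rank-cover = λ {x} {y} (x≺y , none) → cover x y x≺y none
    }

data Letter : Set where
  L R : Letter

#L #R : List Letter → ℕ
#L []      = 0
#L (L ∷ w) = suc (#L w)
#L (R ∷ w) = #L w
#R []      = 0
#R (L ∷ w) = #R w
#R (R ∷ w) = suc (#R w)

-- The positions p with letter R at p and L at p + 1, when the first letter
-- of the word is at position s.
descentsFrom : ℕ → List Letter → List ℕ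
descentsFrom s []          = []
descentsFrom s (L ∷ w)     = descentsFrom (suc s) w
descentsFrom s (R ∷ [])    = []
descentsFrom s (R ∷ R ∷ w) = descentsFrom (suc s) (R ∷ w)
descentsFrom s (R ∷ L ∷ w) = s ∷ descentsFrom (suc s) (L ∷ w)

descents : List Letter → List ℕ
descents = descentsFrom 1

-- Words of unit steps from (i , c) to (j , d): L decreases the row and R
-- increases the column, and every cell visited satisfies the bound b.
IsBoundedWord : (b : ℕ → ℕ) (x y : ℕ × ℕ) → List Letter → Set
IsBoundedWord b (i , c) (j , d) w =
  (#L w ≡ i ∸ j × #R w ≡ d ∸ c) × All (λ p → c + #R p ≤ b (i ∸ #L p)) (inits w)

isBoundedWord? : ∀ b x y → U.Decidable (IsBoundedWord b x y)
isBoundedWord? b (i , c) (j , d) w =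
  ((#L w ≟ i ∸ j) ×-dec (#R w ≟ d ∸ c))
    ×-dec All.all? (λ p → c + #R p ≤? b (i ∸ #L p)) (inits w)

boundedWords : (b : ℕ → ℕ) (x y : ℕ × ℕ) → List (List Letter)
boundedWords b x@(i , c) y@(j , d) =
  filter (isBoundedWord? b x y) (listsOfLength ((i ∸ j) + (d ∸ c)) (L ∷ R ∷ []))

wordPolynomial : (b : ℕ → ℕ) (x y : ℕ × ℕ) → Series-qt
wordPolynomial b x y m n =
  ∑ (boundedWords b x y) λ w → (q^ sum (descents w) t^ length (descents w)) m n

{-# OPTIONS --safe #-}

-- Let Z(i,c) be the series of the weak chains above the cell (i,c). If (i,c)
-- lies in the interval and has relative rank a, then inclusion-exclusion over
-- the two upward steps gives
--   (1 - qᵃ t) Z(i,c) = Z(i-1,c) + X(i,c+1),   X(i,c) = Z(i,c) - Z(i-1,c),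
-- where X(i,c+1) vanishes if (i,c+1) violates the bound. The words that continue
-- (i,c) to the top satisfy the same recursion: those beginning with L correspond
-- to the first summand and those beginning with R to the second. Since an L after
-- an R at position a creates the factor qᵃ t, the words preceded by an R have the
-- series X(i,c) (1 - qᵃ t) ⋯ (1 - qʰ t) when all words have the series
-- Z(i,c) (1 - qᵃ t) ⋯ (1 - qʰ t), by a simultaneous induction on the length.
module Submission where

open import Data.Bool.Base using (Bool; true; false; _∧_; if_then_else_)
open import Data.Integer.Base using (ℤ; 0ℤ; 1ℤ)
import Data.Integer.Base as ℤ using (_+_; _*_; _-_)
import Data.Integer.Properties as ℤ
open import Data.Integer.Tactic.RingSolver using (solve-∀)
open import Data.List.Base
  using (List; []; _∷_; _++_; map; foldr; filter; length; inits; upTo; applyUpTo;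
         cartesianProductWith)
open import Data.List.Extrema.Nat using (max≤v⁺; v≤max⁺)
open import Data.List.Membership.Propositional using (_∈_)
open import Data.List.Membership.Propositional.Properties using (∈-map⁻)
open import Data.List.Properties using (map-applyUpTo; map-upTo)
open import Data.List.Relation.Unary.All as All using (All; []; _∷_)
import Data.List.Relation.Unary.All.Properties as All
open import Data.List.Relation.Unary.AllPairs using ([]; _∷_)
import Data.List.Relation.Unary.AllPairs.Properties as AllPairs
open import Data.List.Relation.Unary.Any as Any using (here; there)
import Data.List.Relation.Unary.Any.Properties as Any
open import Data.List.Relation.Unary.Linked using (linked?)
open import Data.List.Relation.Unary.Unique.Propositional using (Unique)
open import Data.Nat.Base
  using (ℕ; zero; suc; _+_; _∸_; _≤_; _<_; z≤n; s≤s; _≡ᵇ_; _≤ᵇ_; _<ᵇ_)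
open import Data.Nat.ListAction using (sum)
import Data.Nat.Properties as ℕ
import Data.Nat.Tactic.RingSolver as ℕ
open import Data.Product.Base using (_×_; _,_; proj₁; proj₂)
open import Data.Product.Properties using (×-≡,≡→≡; ×-≡,≡←≡)
open import Data.Sum.Base as Sum using (_⊎_; inj₁; inj₂)
open import Function.Base using (_∘_)
open import Function.Bundles using (_⇔_; mk⇔)
open import Relation.Binary.Bundles using (DecPoset)
open import Relation.Binary.Definitions using (DecidableEquality)
open import Relation.Binary.PropositionalEquality
open import Relation.Nullary using (¬_; yes; no; contradiction)
open import Relation.Nullary.Decidable
  using (does; dec-true; dec-false; does-⇔; map′; _×-dec_)
import Relation.Unary as U
open import Defs

private
  variable
    A B C : Set

-- Indicators and finite sums of integers.

⟦_⟧ : Bool → ℤ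
⟦ b ⟧ = if b then 1ℤ else 0ℤ

⟦∧⟧ : ∀ a b → ⟦ a ∧ b ⟧ ≡ ⟦ a ⟧ ℤ.* ⟦ b ⟧
⟦∧⟧ true  b = sym (ℤ.*-identityˡ ⟦ b ⟧)
⟦∧⟧ false b = refl

∑-cong-∈ : {f g : A → ℤ} (xs : List A) → (∀ {x} → x ∈ xs → f x ≡ g x) → ∑ xs f ≡ ∑ xs g
∑-cong-∈ []       f≡g = refl
∑-cong-∈ (x ∷ xs) f≡g = cong₂ ℤ._+_ (f≡g (here refl)) (∑-cong-∈ xs (f≡g ∘ there))

∑-cong : {f g : A → ℤ} (xs : List A) → (∀ x → f x ≡ g x) → ∑ xs f ≡ ∑ xs g
∑-cong xs f≡g = ∑-cong-∈ xs λ {x} _ → f≡g x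

∑-zero : (xs : List A) → ∑ xs (λ _ → 0ℤ) ≡ 0ℤ
∑-zero []       = refl
∑-zero (x ∷ xs) = trans (ℤ.+-identityˡ _) (∑-zero xs)

∑-+ : (xs : List A) (f g : A → ℤ) → ∑ xs (λ x → f x ℤ.+ g x) ≡ ∑ xs f ℤ.+ ∑ xs g
∑-+ []       f g = refl
∑-+ (x ∷ xs) f g = trans (cong (λ z → (f x ℤ.+ g x) ℤ.+ z) (∑-+ xs f g)) (rearrange (f x) (g x) _ _)
  where
  rearrange : ∀ u v s t → (u ℤ.+ v) ℤ.+ (s ℤ.+ t) ≡ (u ℤ.+ s) ℤ.+ (v ℤ.+ t)
  rearrange = solve-∀

∑-sub : (xs : List A) (f g : A → ℤ) → ∑ xs (λ x → f x ℤ.- g x) ≡ ∑ xs f ℤ.- ∑ xs g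
∑-sub []       f g = refl
∑-sub (x ∷ xs) f g = trans (cong (λ z → (f x ℤ.- g x) ℤ.+ z) (∑-sub xs f g)) (rearrange (f x) (g x) _ _)
  where
  rearrange : ∀ u v s t → (u ℤ.- v) ℤ.+ (s ℤ.- t) ≡ (u ℤ.+ s) ℤ.- (v ℤ.+ t)
  rearrange = solve-∀

∑-*ˡ : (c : ℤ) (xs : List A) (f : A → ℤ) → ∑ xs (λ x → c ℤ.* f x) ≡ c ℤ.* ∑ xs f
∑-*ˡ c []       f = sym (ℤ.*-zeroʳ c)
∑-*ˡ c (x ∷ xs) f =
  trans (cong (ℤ._+_ (c ℤ.* f x)) (∑-*ˡ c xs f)) (sym (ℤ.*-distribˡ-+ c (f x) _))

∑-map : (h : A → B) (xs : List A) (f : B → ℤ) → ∑ (map h xs) f ≡ ∑ xs (f ∘ h)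
∑-map h []       f = refl
∑-map h (x ∷ xs) f = cong (ℤ._+_ (f (h x))) (∑-map h xs f)

∑-++ : (xs ys : List A) (f : A → ℤ) → ∑ (xs ++ ys) f ≡ ∑ xs f ℤ.+ ∑ ys f
∑-++ []       ys f = sym (ℤ.+-identityˡ _)
∑-++ (x ∷ xs) ys f = trans (cong (ℤ._+_ (f x)) (∑-++ xs ys f)) (sym (ℤ.+-assoc (f x) _ _))

∑-cartesianProductWith : (h : A → B → C) (xs : List A) (ys : List B) (f : C → ℤ) →
  ∑ (cartesianProductWith h xs ys) f ≡ ∑ xs (λ x → ∑ ys (λ y → f (h x y)))
∑-cartesianProductWith h []       ys f = refl
∑-cartesianProductWith h (x ∷ xs) ys f =
  trans (∑-++ (map (h x) ys) _ f)
        (cong₂ ℤ._+_ (∑-map (h x) ys f) (∑-cartesianProductWith h xs ys f))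

∑-filter : {P : A → Set} (P? : U.Decidable P) (xs : List A) (f : A → ℤ) →
  ∑ (filter P? xs) f ≡ ∑ xs (λ x → ⟦ does (P? x) ⟧ ℤ.* f x)
∑-filter P? []       f = refl
∑-filter P? (x ∷ xs) f with does (P? x)
... | true  = cong₂ ℤ._+_ (sym (ℤ.*-identityˡ (f x))) (∑-filter P? xs f)
... | false = trans (∑-filter P? xs f) (sym (ℤ.+-identityˡ _))

∑-upTo-suc : ∀ n (f : ℕ → ℤ) → ∑ (upTo (suc n)) f ≡ f 0 ℤ.+ ∑ (upTo n) (f ∘ suc)
∑-upTo-suc n f = cong (λ xs → f 0 ℤ.+ foldr ℤ._+_ 0ℤ xs)
  (trans (map-applyUpTo suc f n) (sym (map-upTo (f ∘ suc) n)))

-- Multiplication of power series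

-- The product `*ₛ` unfolds to a `diag` in the exponent of t of a `diag` in the exponent of q, so
-- one set of lemmas serves both variables.
diag : (ℕ → ℕ → ℤ) → ℕ → ℤ
diag H m = ∑ (upTo (suc m)) λ k → H k (m ∸ k)

diag-cong : ∀ {H K} → (∀ k l → H k l ≡ K k l) → ∀ m → diag H m ≡ diag K m
diag-cong H≡K m = ∑-cong (upTo (suc m)) λ k → H≡K k (m ∸ k)

diag-zero : ∀ {H} → (∀ k l → H k l ≡ 0ℤ) → ∀ m → diag H m ≡ 0ℤ
diag-zero H≡0 m = trans (diag-cong H≡0 m) (∑-zero (upTo (suc m)))

diag-+ : ∀ H K m → diag (λ k l → H k l ℤ.+ K k l) m ≡ diag H m ℤ.+ diag K m
diag-+ H K m = ∑-+ (upTo (suc m)) (λ k → H k (m ∸ k)) (λ k → K k (m ∸ k))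

diag-sub : ∀ H K m → diag (λ k l → H k l ℤ.- K k l) m ≡ diag H m ℤ.- diag K m
diag-sub H K m = ∑-sub (upTo (suc m)) (λ k → H k (m ∸ k)) (λ k → K k (m ∸ k))

diag-suc : ∀ H m → diag H (suc m) ≡ H 0 (suc m) ℤ.+ diag (H ∘ suc) m
diag-suc H m = ∑-upTo-suc (suc m) λ k → H k (suc m ∸ k)

diag-shiftˡ : ∀ H → (∀ l → H 0 l ≡ 0ℤ) → ∀ m → diag H (suc m) ≡ diag (H ∘ suc) m
diag-shiftˡ H H0 m =
  trans (diag-suc H m) (trans (cong (λ z → z ℤ.+ diag (H ∘ suc) m) (H0 (suc m))) (ℤ.+-identityˡ _))

-- The vanishing summand is the last one, while `diag-suc` splits off the first; hence the
-- induction.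
diag-shiftʳ : ∀ H → (∀ k → H k 0 ≡ 0ℤ) → ∀ m → diag H (suc m) ≡ diag (λ k l → H k (suc l)) m
diag-shiftʳ H H0 zero    = cong (λ z → H 0 1 ℤ.+ (z ℤ.+ 0ℤ)) (H0 1)
diag-shiftʳ H H0 (suc m) = trans (diag-suc H (suc m))
  (trans (cong (ℤ._+_ (H 0 (suc (suc m)))) (diag-shiftʳ (H ∘ suc) (H0 ∘ suc) m))
         (sym (diag-suc (λ k l → H k (suc l)) m)))

diag-unitˡ : ∀ H → (∀ k l → H (suc k) l ≡ 0ℤ) → ∀ m → diag H m ≡ H 0 m
diag-unitˡ H H0 zero    = ℤ.+-identityʳ (H 0 0)
diag-unitˡ H H0 (suc m) = trans (diag-suc H m)
  (trans (cong (ℤ._+_ (H 0 (suc m))) (diag-zero H0 m)) (ℤ.+-identityʳ _))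

diag-unitʳ : ∀ H → (∀ k l → H k (suc l) ≡ 0ℤ) → ∀ m → diag H m ≡ H m 0
diag-unitʳ H H0 zero    = ℤ.+-identityʳ (H 0 0)
diag-unitʳ H H0 (suc m) = trans (diag-suc H m)
  (trans (cong₂ ℤ._+_ (H0 0 m) (diag-unitʳ (H ∘ suc) (H0 ∘ suc) m)) (ℤ.+-identityˡ _))

-- Multiplication by qᵃ, defined by recursion so that it computes.
shift : ℕ → Series-q → Series-q
shift zero    f n       = f n
shift (suc a) f zero    = 0ℤ
shift (suc a) f (suc n) = shift a f n

shift-cong : ∀ a {f g} → (∀ n → f n ≡ g n) → ∀ n → shift a f n ≡ shift a g n
shift-cong zero    f≡g n       = f≡g n
shift-cong (suc a) f≡g zero    = refl
shift-cong (suc a) f≡g (suc n) = shift-cong a f≡g n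

shift-zero : ∀ a n → shift a (λ _ → 0ℤ) n ≡ 0ℤ
shift-zero zero    n       = refl
shift-zero (suc a) zero    = refl
shift-zero (suc a) (suc n) = shift-zero a n

shift-∑ : ∀ a (xs : List A) (f : A → Series-q) n →
  shift a (λ k → ∑ xs λ x → f x k) n ≡ ∑ xs λ x → shift a (f x) n
shift-∑ zero    xs f n       = refl
shift-∑ (suc a) xs f zero    = sym (∑-zero xs)
shift-∑ (suc a) xs f (suc n) = shift-∑ a xs f n

shift-sub : ∀ a f g n → shift a (λ k → f k ℤ.- g k) n ≡ shift a f n ℤ.- shift a g n
shift-sub zero    f g n       = refl
shift-sub (suc a) f g zero    = refl
shift-sub (suc a) f g (suc n) = shift-sub a f g n

shift-*ˡ : ∀ a c f n → shift a (λ k → c ℤ.* f k) n ≡ c ℤ.* shift a f n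
shift-*ˡ zero    c f n       = refl
shift-*ˡ (suc a) c f zero    = sym (ℤ.*-zeroʳ c)
shift-*ˡ (suc a) c f (suc n) = shift-*ˡ a c f n

shift-q^ : ∀ a s n → (q^ (a + s)) n ≡ shift a (q^ s) n
shift-q^ zero    s n       = refl
shift-q^ (suc a) s zero    = refl
shift-q^ (suc a) s (suc n) = shift-q^ a s n

cauchy : Series-q → Series-q → Series-q
cauchy f g = diag λ l l′ → f l ℤ.* g l′

cauchy-shiftˡ : ∀ a f g n → cauchy (shift a f) g n ≡ shift a (cauchy f g) n
cauchy-shiftˡ zero    f g n       = refl
cauchy-shiftˡ (suc a) f g zero    = refl
cauchy-shiftˡ (suc a) f g (suc n) =
  trans (diag-shiftˡ (λ l l′ → shift (suc a) f l ℤ.* g l′) (λ l → refl) n) (cauchy-shiftˡ a f g n)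

cauchy-shiftʳ : ∀ a f g n → cauchy f (shift a g) n ≡ shift a (cauchy f g) n
cauchy-shiftʳ zero    f g n       = refl
cauchy-shiftʳ (suc a) f g zero    = trans (ℤ.+-identityʳ _) (ℤ.*-zeroʳ (f 0))
cauchy-shiftʳ (suc a) f g (suc n) =
  trans (diag-shiftʳ (λ l l′ → f l ℤ.* shift (suc a) g l′) (λ l → ℤ.*-zeroʳ (f l)) n)
        (cauchy-shiftʳ a f g n)

-- Multiplication by qᵃ t.
T : ℕ → Series-qt → Series-qt
T a f zero    n = 0ℤ
T a f (suc m) n = shift a (f m) n

T-cong : ∀ a {f g} → f ≈ₛ g → T a f ≈ₛ T a g
T-cong a f≈g zero    n = refl
T-cong a f≈g (suc m) n = shift-cong a (f≈g m) n

T-zero : ∀ a {f} → (∀ m n → f m n ≡ 0ℤ) → ∀ m n → T a f m n ≡ 0ℤ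
T-zero a f≡0 zero    n = refl
T-zero a f≡0 (suc m) n = trans (shift-cong a (f≡0 m) n) (shift-zero a n)

T-sub : ∀ a f g → T a (f -ₛ g) ≈ₛ T a f -ₛ T a g
T-sub a f g zero    n = refl
T-sub a f g (suc m) n = shift-sub a (f m) (g m) n

-- On words: one more descent, at position `a`, raises the sum of the descents by `a` and their
-- number by one.
T-q^t^ : ∀ a s k → q^ (a + s) t^ suc k ≈ₛ T a (q^ s t^ k)
T-q^t^ a s k zero    n = refl
T-q^t^ a s k (suc m) n with k ≡ᵇ m
... | true  = shift-q^ a s n
... | false = sym (shift-zero a n)

*ₛ-congʳ : ∀ h {f g} → f ≈ₛ g → f *ₛ h ≈ₛ g *ₛ h
*ₛ-congʳ h f≈g m n =
  diag-cong (λ k k′ → diag-cong (λ l l′ → cong (λ z → z ℤ.* h k′ l′) (f≈g k l)) n) m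

*ₛ-congˡ : ∀ h {f g} → f ≈ₛ g → h *ₛ f ≈ₛ h *ₛ g
*ₛ-congˡ h f≈g m n =
  diag-cong (λ k k′ → diag-cong (λ l l′ → cong (ℤ._*_ (h k l)) (f≈g k′ l′)) n) m

*ₛ-zeroˡ : ∀ {f} → (∀ m n → f m n ≡ 0ℤ) → ∀ g m n → (f *ₛ g) m n ≡ 0ℤ
*ₛ-zeroˡ f≡0 g m n =
  diag-zero (λ k k′ → diag-zero (λ l l′ → cong (λ z → z ℤ.* g k′ l′) (f≡0 k l)) n) m

T-*ₛˡ : ∀ a f g → T a f *ₛ g ≈ₛ T a (f *ₛ g)
T-*ₛˡ a f g zero    n = trans (ℤ.+-identityʳ _) (diag-zero (λ l l′ → refl) n)
T-*ₛˡ a f g (suc m) n =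
  trans (diag-shiftˡ (λ k k′ → cauchy (T a f k) (g k′) n) (λ l → diag-zero (λ _ _ → refl) n) m)
  (trans (diag-cong (λ k k′ → cauchy-shiftˡ a (f k) (g k′) n) m)
         (sym (shift-∑ a (upTo (suc m)) (λ k → cauchy (f k) (g (m ∸ k))) n)))

T-*ₛʳ : ∀ a f g → f *ₛ T a g ≈ₛ T a (f *ₛ g)
T-*ₛʳ a f g zero    n = trans (ℤ.+-identityʳ _) (diag-zero (λ l l′ → ℤ.*-zeroʳ (f 0 l)) n)
T-*ₛʳ a f g (suc m) n =
  trans (diag-shiftʳ (λ k k′ → cauchy (f k) (T a g k′) n)
          (λ k → diag-zero (λ l _ → ℤ.*-zeroʳ (f k l)) n) m)
  (trans (diag-cong (λ k k′ → cauchy-shiftʳ a (f k) (g k′) n) m)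
         (sym (shift-∑ a (upTo (suc m)) (λ k → cauchy (f k) (g (m ∸ k))) n)))

𝟙 : Series-qt
𝟙 = q^ 0 t^ 0

*ₛ-identityˡ : ∀ f → 𝟙 *ₛ f ≈ₛ f
*ₛ-identityˡ f m n =
  trans (diag-unitˡ (λ k k′ → cauchy (𝟙 k) (f k′) n) (λ k l → diag-zero (λ _ _ → refl) n) m)
  (trans (diag-unitˡ (λ l l′ → 𝟙 0 l ℤ.* f m l′) (λ _ _ → refl) n) (ℤ.*-identityˡ _))

*ₛ-identityʳ : ∀ f → f *ₛ 𝟙 ≈ₛ f
*ₛ-identityʳ f m n =
  trans (diag-unitʳ (λ k k′ → cauchy (f k) (𝟙 k′) n)
          (λ k l → diag-zero (λ l _ → ℤ.*-zeroʳ (f k l)) n) m)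
  (trans (diag-unitʳ (λ l l′ → f m l ℤ.* 𝟙 0 l′) (λ l _ → ℤ.*-zeroʳ (f m l)) n)
         (ℤ.*-identityʳ _))

infixl 6 _+ₛ_
_+ₛ_ : Series-qt → Series-qt → Series-qt
(f +ₛ g) m n = f m n ℤ.+ g m n

*ₛ-distribʳ-+ : ∀ h f g → (f +ₛ g) *ₛ h ≈ₛ f *ₛ h +ₛ g *ₛ h
*ₛ-distribʳ-+ h f g m n = trans
  (diag-cong (λ k k′ → trans
    (diag-cong (λ l l′ → ℤ.*-distribʳ-+ (h k′ l′) (f k l) (g k l)) n)
    (diag-+ (λ l l′ → f k l ℤ.* h k′ l′) (λ l l′ → g k l ℤ.* h k′ l′) n)) m)
  (diag-+ (λ k k′ → cauchy (f k) (h k′) n) (λ k k′ → cauchy (g k) (h k′) n) m)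

*ₛ-distribʳ-sub : ∀ h f g → (f -ₛ g) *ₛ h ≈ₛ f *ₛ h -ₛ g *ₛ h
*ₛ-distribʳ-sub h f g m n = trans
  (diag-cong (λ k k′ → trans
    (diag-cong (λ l l′ → distrib (f k l) (g k l) (h k′ l′)) n)
    (diag-sub (λ l l′ → f k l ℤ.* h k′ l′) (λ l l′ → g k l ℤ.* h k′ l′) n)) m)
  (diag-sub (λ k k′ → cauchy (f k) (h k′) n) (λ k k′ → cauchy (g k) (h k′) n) m)
  where
  distrib : ∀ u v w → (u ℤ.- v) ℤ.* w ≡ u ℤ.* w ℤ.- v ℤ.* w
  distrib = solve-∀

*ₛ-distribˡ-sub : ∀ h f g → h *ₛ (f -ₛ g) ≈ₛ h *ₛ f -ₛ h *ₛ g
*ₛ-distribˡ-sub h f g m n = trans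
  (diag-cong (λ k k′ → trans
    (diag-cong (λ l l′ → distrib (f k′ l′) (g k′ l′) (h k l)) n)
    (diag-sub (λ l l′ → h k l ℤ.* f k′ l′) (λ l l′ → h k l ℤ.* g k′ l′) n)) m)
  (diag-sub (λ k k′ → cauchy (h k) (f k′) n) (λ k k′ → cauchy (h k) (g k′) n) m)
  where
  distrib : ∀ u v w → w ℤ.* (u ℤ.- v) ≡ w ℤ.* u ℤ.- w ℤ.* v
  distrib = solve-∀

-- The factors 1 - qᵃ t of the denominator.

factor : ℕ → Series-qt
factor a = 𝟙 -ₛ q^ a t^ 1

q^t*ₛ : ∀ a f → (q^ a t^ 1) *ₛ f ≈ₛ T a f
q^t*ₛ a f m n = trans (*ₛ-congʳ f q^at≈T𝟙 m n)
  (trans (T-*ₛˡ a 𝟙 f m n) (T-cong a (*ₛ-identityˡ f) m n))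
  where
  q^at≈T𝟙 : q^ a t^ 1 ≈ₛ T a 𝟙
  q^at≈T𝟙 = subst (λ s → q^ s t^ 1 ≈ₛ T a 𝟙) (ℕ.+-identityʳ a) (T-q^t^ a 0 0)

-- Multiplication by qᵃ t can be carried out on either factor of a product. So the leading factor of
-- the denominator can be absorbed into the series of chains, where the recursion for chains
-- applies.
*ₛ-factor : ∀ a f g → f *ₛ (factor a *ₛ g) ≈ₛ (f -ₛ T a f) *ₛ g
*ₛ-factor a f g m n = begin
  (f *ₛ (factor a *ₛ g)) m n           ≡⟨ *ₛ-congˡ f factor*g m n ⟩
  (f *ₛ (g -ₛ T a g)) m n              ≡⟨ *ₛ-distribˡ-sub f g (T a g) m n ⟩
  (f *ₛ g) m n ℤ.- (f *ₛ T a g) m n    ≡⟨ cong (ℤ._-_ ((f *ₛ g) m n)) T-comm ⟩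
  (f *ₛ g) m n ℤ.- (T a f *ₛ g) m n    ≡⟨ *ₛ-distribʳ-sub g f (T a f) m n ⟨
  ((f -ₛ T a f) *ₛ g) m n              ∎
  where
  open ≡-Reasoning
  factor*g : factor a *ₛ g ≈ₛ g -ₛ T a g
  factor*g m n = trans (*ₛ-distribʳ-sub g 𝟙 (q^ a t^ 1) m n)
    (cong₂ ℤ._-_ (*ₛ-identityˡ g m n) (q^t*ₛ a g m n))
  T-comm : (f *ₛ T a g) m n ≡ (T a f *ₛ g) m n
  T-comm = trans (T-*ₛʳ a f g m n) (sym (T-*ₛˡ a f g m n))

∏ : ℕ → ℕ → Series-qt
∏ a zero    = 𝟙
∏ a (suc ℓ) = factor a *ₛ ∏ (suc a) ℓ

-- Each unfolding of `applyUpTo` composes its function with `suc`, so the induction runs over any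
-- `f` that agrees pointwise with `a +_`.
foldr-factors : ∀ ℓ a (f : ℕ → ℕ) → (∀ k → f k ≡ a + k) →
  foldr _*ₛ_ 𝟙 (map factor (applyUpTo f ℓ)) ≡ ∏ a ℓ
foldr-factors zero    a f f≡ = refl
foldr-factors (suc ℓ) a f f≡ = cong₂ (λ e → factor e *ₛ_)
  (trans (f≡ 0) (ℕ.+-identityʳ a))
  (foldr-factors ℓ (suc a) (f ∘ suc) λ k → trans (f≡ (suc k)) (ℕ.+-suc a k))

denominator≡∏ : ∀ P → denominator P ≡ ∏ 0 (suc (maxRank P))
denominator≡∏ P = foldr-factors (suc (maxRank P)) 0 (λ k → k) (λ k → refl)

-- Weak chains above a cell

∑-indicator : (_≟_ : DecidableEquality A) {xs : List A} → Unique xs → (f : A → ℤ) →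
  ∀ {u} → u ∈ xs → ∑ xs (λ v → ⟦ does (v ≟ u) ⟧ ℤ.* f v) ≡ f u
∑-indicator _≟_ {x ∷ xs} (x∉ ∷ _) f (here refl) = begin
  ⟦ does (x ≟ x) ⟧ ℤ.* f x ℤ.+ ∑ xs (λ v → ⟦ does (v ≟ x) ⟧ ℤ.* f v)
    ≡⟨ cong₂ (λ b z → ⟦ b ⟧ ℤ.* f x ℤ.+ z) (dec-true (x ≟ x) refl)
               (trans (∑-cong-∈ xs absent) (∑-zero xs)) ⟩
  1ℤ ℤ.* f x ℤ.+ 0ℤ
    ≡⟨ trans (ℤ.+-identityʳ _) (ℤ.*-identityˡ (f x)) ⟩
  f x ∎
  where
  open ≡-Reasoning
  absent : ∀ {v} → v ∈ xs → ⟦ does (v ≟ x) ⟧ ℤ.* f v ≡ 0ℤ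
  absent {v} v∈ = cong (λ b → ⟦ b ⟧ ℤ.* f v)
    (dec-false (v ≟ x) λ v≡x → All.lookup x∉ v∈ (sym v≡x))
∑-indicator _≟_ {x ∷ xs} (x∉ ∷ uniq) f {u} (there u∈) = trans
  (cong₂ (λ b z → ⟦ b ⟧ ℤ.* f x ℤ.+ z)
    (dec-false (x ≟ u) (All.lookup x∉ u∈)) (∑-indicator _≟_ uniq f u∈))
  (ℤ.+-identityˡ (f u))

⟦<ᵇ-suc⟧ : ∀ m n → ⟦ m <ᵇ suc n ⟧ ≡ ⟦ m <ᵇ n ⟧ ℤ.+ ⟦ m ≡ᵇ n ⟧
⟦<ᵇ-suc⟧ zero    zero    = refl
⟦<ᵇ-suc⟧ zero    (suc n) = refl
⟦<ᵇ-suc⟧ (suc m) zero    = refl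
⟦<ᵇ-suc⟧ (suc m) (suc n) = ⟦<ᵇ-suc⟧ m n

⟦≤ᵇ-suc⟧ : ∀ m n → ⟦ m ≤ᵇ suc n ⟧ ≡ ⟦ m ≤ᵇ n ⟧ ℤ.+ ⟦ m ≡ᵇ suc n ⟧
⟦≤ᵇ-suc⟧ zero    n = refl
⟦≤ᵇ-suc⟧ (suc m) n = ⟦<ᵇ-suc⟧ m n

⟦≤ᵇ⟧ : ∀ m n → ⟦ m ≤ᵇ n ⟧ ≡ ⟦ m <ᵇ n ⟧ ℤ.+ ⟦ n ≡ᵇ m ⟧
⟦≤ᵇ⟧ zero          zero    = refl
⟦≤ᵇ⟧ zero          (suc n) = refl
⟦≤ᵇ⟧ (suc m)       zero    = refl
-- `_≤ᵇ_` reduces to `_<ᵇ_` only when its left argument is a successor, so the predecessor has to be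
-- split once more before the recursive call fits.
⟦≤ᵇ⟧ (suc zero)    (suc n) = ⟦≤ᵇ⟧ zero n
⟦≤ᵇ⟧ (suc (suc m)) (suc n) = ⟦≤ᵇ⟧ (suc m) n

_⊑?_ = DecPoset._≤?_ ⊑-decPoset

-- Unlike ≡-dec, this reduces to a conjunction of the two componentwise tests.
_≟×_ : DecidableEquality (ℕ × ℕ)
(i , c) ≟× (i′ , c′) = map′ ×-≡,≡→≡ ×-≡,≡←≡ ((i ℕ.≟ i′) ×-dec (c ℕ.≟ c′))

-- An integer product in place of a Boolean conjunction turns inclusion-exclusion into a ring
-- identity.
⟦⊑⟧ : ℕ × ℕ → ℕ × ℕ → ℤ
⟦⊑⟧ (i , c) (i′ , c′) = ⟦ i′ ≤ᵇ i ⟧ ℤ.* ⟦ c ≤ᵇ c′ ⟧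

⟦⊑?⟧ : ∀ u v → ⟦ does (u ⊑? v) ⟧ ≡ ⟦⊑⟧ u v
⟦⊑?⟧ (i , c) (i′ , c′) = ⟦∧⟧ (i′ ≤ᵇ i) (c ≤ᵇ c′)

module Multichains (es : List (ℕ × ℕ)) (ρ : ℕ × ℕ → ℕ) (j : ℕ) where

  -- The coefficient of tᵐ sums over the weak chains of m elements of es, all of
  -- them ⊒ u. The empty chain counts only for u in a row i ≥ j, the row of the
  -- top: thus Z vanishes below row j, where no word ends at the top.
  Z : ℕ × ℕ → Series-qt
  Z u zero    n = ⟦ j ≤ᵇ proj₁ u ⟧ ℤ.* (q^ 0) n
  Z u (suc m) n = ∑ es λ v → ⟦⊑⟧ u v ℤ.* shift (ρ v) (Z v m) n

  -- Inclusion-exclusion on the least element of a chain: the up-sets of `(i , c)` and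
  -- `(suc i , suc c)` meet in that of `(i , suc c)`, and their union misses only `(suc i , c)` from
  -- the up-set of `(suc i , c)`. Chains starting at that cell itself give the term with `T`.
  Z-corner : Unique es → ∀ {i c} → (suc i , c) ∈ es → ∀ m n →
    Z (suc i , c) m n ℤ.+ Z (i , suc c) m n ≡
    T (ρ (suc i , c)) (Z (suc i , c)) m n ℤ.+ (Z (i , c) m n ℤ.+ Z (suc i , suc c) m n)
  -- The empty chain is weighted by the row alone, so both sides have the same two terms in opposite
  -- order.
  Z-corner uniq {i} {c} u∈ zero    n = trans
    (ℤ.+-comm (Z (suc i , c) 0 n) (Z (i , suc c) 0 n))
    (sym (ℤ.+-identityˡ (Z (i , c) 0 n ℤ.+ Z (suc i , suc c) 0 n)))
  Z-corner uniq {i} {c} u∈ (suc m) n = begin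
    ∑ es (f (suc i , c)) ℤ.+ ∑ es (f (i , suc c))
      ≡⟨ ∑-+ es (f (suc i , c)) (f (i , suc c)) ⟨
    ∑ es (λ v → f (suc i , c) v ℤ.+ f (i , suc c) v)
      ≡⟨ ∑-cong es pointwise ⟩
    ∑ es (λ v → δ v ℤ.+ (f (i , c) v ℤ.+ f (suc i , suc c) v))
      ≡⟨ ∑-+ es δ (λ v → f (i , c) v ℤ.+ f (suc i , suc c) v) ⟩
    ∑ es δ ℤ.+ ∑ es (λ v → f (i , c) v ℤ.+ f (suc i , suc c) v)
      ≡⟨ cong₂ ℤ._+_ (∑-indicator _≟×_ uniq g u∈) (∑-+ es (f (i , c)) (f (suc i , suc c))) ⟩
    g (suc i , c) ℤ.+ (∑ es (f (i , c)) ℤ.+ ∑ es (f (suc i , suc c))) ∎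
    where
    open ≡-Reasoning
    g : ℕ × ℕ → ℤ
    g v = shift (ρ v) (Z v m) n
    f : ℕ × ℕ → ℕ × ℕ → ℤ
    f u v = ⟦⊑⟧ u v ℤ.* g v
    δ : ℕ × ℕ → ℤ
    δ v = ⟦ does (v ≟× (suc i , c)) ⟧ ℤ.* g v
    -- `β` and `ι` stand for a row at most `i` and equal to `suc i`, `γ` and `κ` for a column beyond
    -- `c` and equal to `c`.
    expand : ∀ β ι γ κ x →
      ((β ℤ.+ ι) ℤ.* (γ ℤ.+ κ)) ℤ.* x ℤ.+ (β ℤ.* γ) ℤ.* x ≡
      (ι ℤ.* κ) ℤ.* x ℤ.+ ((β ℤ.* (γ ℤ.+ κ)) ℤ.* x ℤ.+ ((β ℤ.+ ι) ℤ.* γ) ℤ.* x)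
    expand = solve-∀
    pointwise : ∀ v → f (suc i , c) v ℤ.+ f (i , suc c) v ≡
      δ v ℤ.+ (f (i , c) v ℤ.+ f (suc i , suc c) v)
    pointwise v@(i′ , c′)
      rewrite ⟦∧⟧ (i′ ≡ᵇ suc i) (c′ ≡ᵇ c) | ⟦≤ᵇ-suc⟧ i′ i | ⟦≤ᵇ⟧ c c′
      = expand ⟦ i′ ≤ᵇ i ⟧ ⟦ i′ ≡ᵇ suc i ⟧ ⟦ c <ᵇ c′ ⟧ ⟦ c′ ≡ᵇ c ⟧ (g v)

  Z-below : (∀ {v} → v ∈ es → j ≤ proj₁ v) → ∀ {i c} → i < j → ∀ m n → Z (i , c) m n ≡ 0ℤ
  Z-below rows {i} i<j zero    n = cong (λ b → ⟦ b ⟧ ℤ.* (q^ 0) n) (dec-false (j ℕ.≤? i) (ℕ.<⇒≱ i<j))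
  Z-below rows {i} {c} i<j (suc m) n = trans
    (∑-cong-∈ es λ {v} v∈ → cong (λ b → ⟦ b ⟧ ℤ.* ⟦ c ≤ᵇ proj₂ v ⟧ ℤ.* shift (ρ v) (Z v m) n)
      (dec-false (proj₁ v ℕ.≤? i) (ℕ.<⇒≱ (ℕ.<-≤-trans i<j (rows v∈)))))
    (∑-zero es)

  Z-right : ∀ {i c} → (∀ {v} → v ∈ es → proj₂ v < c) → j ≤ i → Z (i , c) ≈ₛ 𝟙
  Z-right {i} {c} cols j≤i zero    n =
    trans (cong (λ b → ⟦ b ⟧ ℤ.* (q^ 0) n) (dec-true (j ℕ.≤? i) j≤i)) (ℤ.*-identityˡ _)
  Z-right {i} {c} cols j≤i (suc m) n = trans
    (∑-cong-∈ es λ {v} v∈ → cong (λ z → z ℤ.* shift (ρ v) (Z v m) n)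
      (trans (cong (λ b → ⟦ proj₁ v ≤ᵇ i ⟧ ℤ.* ⟦ b ⟧) (dec-false (c ℕ.≤? proj₂ v) (ℕ.<⇒≱ (cols v∈))))
             (ℤ.*-zeroʳ ⟦ proj₁ v ≤ᵇ i ⟧)))
    (∑-zero es)

  -- The two up-sets differ only in row `suc i`, which has no element from column `c` on; `j ≤ i`
  -- makes the empty chain count on both sides.
  Z-skip-row : ∀ {i c} → j ≤ i → (∀ {v} → v ∈ es → proj₁ v ≡ suc i → proj₂ v < c) →
    Z (suc i , c) ≈ₛ Z (i , c)
  Z-skip-row {i} {c} j≤i row zero    n = cong (λ b → ⟦ b ⟧ ℤ.* (q^ 0) n)
    (trans (dec-true (j ℕ.≤? suc i) (ℕ.m≤n⇒m≤1+n j≤i)) (sym (dec-true (j ℕ.≤? i) j≤i)))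
  Z-skip-row {i} {c} j≤i row (suc m) n =
    ∑-cong-∈ es λ {v} v∈ → cong (λ z → z ℤ.* shift (ρ v) (Z v m) n) (same v∈)
    where
    same : ∀ {v} → v ∈ es → ⟦⊑⟧ (suc i , c) v ≡ ⟦⊑⟧ (i , c) v
    same {i′ , c′} v∈ rewrite ⟦≤ᵇ-suc⟧ i′ i with i′ ℕ.≟ suc i
    ... | yes i′≡ = trans (vanish (⟦ i′ ≤ᵇ i ⟧ ℤ.+ ⟦ i′ ≡ᵇ suc i ⟧)) (sym (vanish ⟦ i′ ≤ᵇ i ⟧))
      where
      vanish : ∀ z → z ℤ.* ⟦ c ≤ᵇ c′ ⟧ ≡ 0ℤ
      vanish z = trans
        (cong (λ b → z ℤ.* ⟦ b ⟧) (dec-false (c ℕ.≤? c′) (ℕ.<⇒≱ (row v∈ i′≡))))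
        (ℤ.*-zeroʳ z)
    ... | no i′≢ = cong (λ z → z ℤ.* ⟦ c ≤ᵇ c′ ⟧)
      (trans (cong (λ b → ⟦ i′ ≤ᵇ i ⟧ ℤ.+ ⟦ b ⟧) (dec-false (i′ ℕ.≟ suc i) i′≢))
             (ℤ.+-identityʳ ⟦ i′ ≤ᵇ i ⟧))

-- The zeta series in terms of chains of cells.

module _ (P : FinGradedPoset) where
  open FinGradedPoset P using (Carrier; _≤ᴾ?_; elements; rank)

  module _ (κ : Carrier → ℕ × ℕ) (ρ : ℕ × ℕ → ℕ) (j : ℕ)
           (≤-κ : ∀ u v → does (u ≤ᴾ? v) ≡ does (κ u ⊑? κ v))
           (rank-κ : ∀ u → rank u ≡ ρ (κ u))
           (rows : ∀ u → j ≤ proj₁ (κ u)) where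
    open Multichains (map κ elements) ρ j

    chain : List Carrier → Series-q
    chain xs n = ⟦ does (linked? _≤ᴾ?_ xs) ⟧ ℤ.* (q^ sum (map rank xs)) n

    chain-∷ : ∀ v w xs n →
      chain (v ∷ w ∷ xs) n ≡ ⟦⊑⟧ (κ v) (κ w) ℤ.* shift (ρ (κ v)) (chain (w ∷ xs)) n
    chain-∷ v w xs n = begin
      ⟦ does (v ≤ᴾ? w) ∧ l ⟧ ℤ.* (q^ (rank v + s)) n
        ≡⟨ cong₂ ℤ._*_ (⟦∧⟧ (does (v ≤ᴾ? w)) l) (shift-q^ (rank v) s n) ⟩
      (⟦ does (v ≤ᴾ? w) ⟧ ℤ.* ⟦ l ⟧) ℤ.* shift (rank v) (q^ s) n
        ≡⟨ ℤ.*-assoc ⟦ does (v ≤ᴾ? w) ⟧ ⟦ l ⟧ _ ⟩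
      ⟦ does (v ≤ᴾ? w) ⟧ ℤ.* (⟦ l ⟧ ℤ.* shift (rank v) (q^ s) n)
        ≡⟨ cong₂ ℤ._*_ (trans (cong ⟦_⟧ (≤-κ v w)) (⟦⊑?⟧ (κ v) (κ w)))
                       (sym (shift-*ˡ (rank v) ⟦ l ⟧ (q^ s) n)) ⟩
      ⟦⊑⟧ (κ v) (κ w) ℤ.* shift (rank v) (chain (w ∷ xs)) n
        ≡⟨ cong (λ r → ⟦⊑⟧ (κ v) (κ w) ℤ.* shift r (chain (w ∷ xs)) n) (rank-κ v) ⟩
      ⟦⊑⟧ (κ v) (κ w) ℤ.* shift (ρ (κ v)) (chain (w ∷ xs)) n ∎
      where
      open ≡-Reasoning
      s = sum (map rank (w ∷ xs))
      l = does (linked? _≤ᴾ?_ (w ∷ xs))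

    -- With the least element `v` fixed, the comparison with the next element `w` is a constant
    -- factor of the sum over the rest, which leaves the recursion that defines `Z`.
    ∑-chain-∷ : ∀ m v n →
      ∑ (listsOfLength m elements) (λ xs → chain (v ∷ xs) n) ≡ shift (ρ (κ v)) (Z (κ v) m) n
    ∑-chain-∷ zero v n = begin
      1ℤ ℤ.* (q^ (rank v + 0)) n ℤ.+ 0ℤ   ≡⟨ trans (ℤ.+-identityʳ _) (ℤ.*-identityˡ _) ⟩
      (q^ (rank v + 0)) n                 ≡⟨ shift-q^ (rank v) 0 n ⟩
      shift (rank v) (q^ 0) n             ≡⟨ cong (λ r → shift r (q^ 0) n) (rank-κ v) ⟩
      shift (ρ (κ v)) (q^ 0) n            ≡⟨ shift-cong (ρ (κ v)) Z₀ n ⟨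
      shift (ρ (κ v)) (Z (κ v) 0) n       ∎
      where
      open ≡-Reasoning
      Z₀ : ∀ n → Z (κ v) 0 n ≡ (q^ 0) n
      Z₀ n = trans (cong (λ b → ⟦ b ⟧ ℤ.* (q^ 0) n) (dec-true (j ℕ.≤? proj₁ (κ v)) (rows v)))
                   (ℤ.*-identityˡ _)
    ∑-chain-∷ (suc m) v n = begin
      ∑ (listsOfLength (suc m) elements) (λ xs → chain (v ∷ xs) n)
        ≡⟨ ∑-cartesianProductWith _∷_ elements ls _ ⟩
      ∑ elements (λ w → ∑ ls λ xs → chain (v ∷ w ∷ xs) n)
        ≡⟨ ∑-cong elements step ⟩
      ∑ elements (λ w → shift r (λ k → ⟦⊑⟧ (κ v) (κ w) ℤ.* shift (ρ (κ w)) (Z (κ w) m) k) n)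
        ≡⟨ shift-∑ r elements _ n ⟨
      shift r (λ k → ∑ elements (λ w → ⟦⊑⟧ (κ v) (κ w) ℤ.* shift (ρ (κ w)) (Z (κ w) m) k)) n
        ≡⟨ shift-cong r (λ k → ∑-map κ elements (λ u → ⟦⊑⟧ (κ v) u ℤ.* shift (ρ u) (Z u m) k)) n ⟨
      shift r (Z (κ v) (suc m)) n ∎
      where
      open ≡-Reasoning
      r = ρ (κ v)
      ls = listsOfLength m elements
      step : ∀ w → ∑ ls (λ xs → chain (v ∷ w ∷ xs) n) ≡
        shift r (λ k → ⟦⊑⟧ (κ v) (κ w) ℤ.* shift (ρ (κ w)) (Z (κ w) m) k) n
      step w = begin
        ∑ ls (λ xs → chain (v ∷ w ∷ xs) n)
          ≡⟨ ∑-cong ls (λ xs → chain-∷ v w xs n) ⟩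
        ∑ ls (λ xs → p ℤ.* shift r (chain (w ∷ xs)) n)
          ≡⟨ ∑-*ˡ p ls (λ xs → shift r (chain (w ∷ xs)) n) ⟩
        p ℤ.* ∑ ls (λ xs → shift r (chain (w ∷ xs)) n)
          ≡⟨ cong (ℤ._*_ p) (shift-∑ r ls (λ xs → chain (w ∷ xs)) n) ⟨
        p ℤ.* shift r (λ k → ∑ ls (λ xs → chain (w ∷ xs) k)) n
          ≡⟨ cong (ℤ._*_ p) (shift-cong r (∑-chain-∷ m w) n) ⟩
        p ℤ.* shift r (shift (ρ (κ w)) (Z (κ w) m)) n
          ≡⟨ shift-*ˡ r p (shift (ρ (κ w)) (Z (κ w) m)) n ⟨
        shift r (λ k → p ℤ.* shift (ρ (κ w)) (Z (κ w) m) k) n ∎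
        where p = ⟦⊑⟧ (κ v) (κ w)

    zetaSeries≈Z : ∀ {u} → j ≤ proj₁ u → (∀ v → u ⊑ κ v) → zetaSeries P ≈ₛ Z u
    zetaSeries≈Z {u} j≤ u⊑ zero n = begin
      (q^ 0) n ℤ.+ 0ℤ                      ≡⟨ ℤ.+-identityʳ _ ⟩
      (q^ 0) n                             ≡⟨ ℤ.*-identityˡ _ ⟨
      1ℤ ℤ.* (q^ 0) n                      ≡⟨ cong (λ b → ⟦ b ⟧ ℤ.* (q^ 0) n)
                                                   (dec-true (j ℕ.≤? proj₁ u) j≤) ⟨
      ⟦ j ≤ᵇ proj₁ u ⟧ ℤ.* (q^ 0) n        ∎
      where open ≡-Reasoning
    zetaSeries≈Z {u} j≤ u⊑ (suc m) n = begin
      ∑ (weakChains P (suc m)) (λ xs → (q^ sum (map rank xs)) n)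
        ≡⟨ ∑-filter (linked? _≤ᴾ?_) (listsOfLength (suc m) elements) _ ⟩
      ∑ (listsOfLength (suc m) elements) (λ xs → chain xs n)
        ≡⟨ ∑-cartesianProductWith _∷_ elements (listsOfLength m elements) _ ⟩
      ∑ elements (λ v → ∑ (listsOfLength m elements) λ xs → chain (v ∷ xs) n)
        -- `u` lies below every element, so the factor inserted here is 1.
        ≡⟨ ∑-cong elements (λ v → trans (∑-chain-∷ m v n) (sym (trans
             (cong (λ z → z ℤ.* shift (ρ (κ v)) (Z (κ v) m) n) (one v)) (ℤ.*-identityˡ _)))) ⟩
      ∑ elements (λ v → ⟦⊑⟧ u (κ v) ℤ.* shift (ρ (κ v)) (Z (κ v) m) n)
        ≡⟨ ∑-map κ elements (λ v → ⟦⊑⟧ u v ℤ.* shift (ρ v) (Z v m) n) ⟨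
      Z u (suc m) n ∎
      where
      open ≡-Reasoning
      one : ∀ v → ⟦⊑⟧ u (κ v) ≡ 1ℤ
      one v = trans (sym (⟦⊑?⟧ u (κ v))) (cong ⟦_⟧ (dec-true (u ⊑? κ v) (u⊑ v)))

-- Words

T-∑ : ∀ a (xs : List A) (c : A → ℤ) (f : A → Series-qt) →
  T a (λ m n → ∑ xs λ x → c x ℤ.* f x m n) ≈ₛ λ m n → ∑ xs λ x → c x ℤ.* T a (f x) m n
T-∑ a xs c f zero    n = sym (trans (∑-cong xs λ x → ℤ.*-zeroʳ (c x)) (∑-zero xs))
T-∑ a xs c f (suc m) n = trans (shift-∑ a xs (λ x k → c x ℤ.* f x m k) n)
  (∑-cong xs λ x → shift-*ˡ a (c x) (f x m) n)

words : ℕ → List (List Letter)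
words ℓ = listsOfLength ℓ (L ∷ R ∷ [])

∑-words-suc : ∀ ℓ (f : List Letter → ℤ) →
  ∑ (words (suc ℓ)) f ≡ ∑ (words ℓ) (f ∘ (L ∷_)) ℤ.+ ∑ (words ℓ) (f ∘ (R ∷_))
∑-words-suc ℓ f = trans (∑-cartesianProductWith _∷_ (L ∷ R ∷ []) (words ℓ) f)
  (cong (ℤ._+_ (∑ (words ℓ) (f ∘ (L ∷_)))) (ℤ.+-identityʳ _))

weight : ℕ → List Letter → Series-qt
weight s w = q^ sum (descentsFrom s w) t^ length (descentsFrom s w)

module Words (b : ℕ → ℕ) where

  -- IsBoundedWord with the numbers p of letters L and k of letters R as indices.
  Good : ℕ → ℕ → ℕ → ℕ → List Letter → Set
  Good i c p k w = (#L w ≡ p × #R w ≡ k) × All (λ u → c + #R u ≤ b (i ∸ #L u)) (inits w)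

  good? : ∀ i c p k → U.Decidable (Good i c p k)
  good? i c p k w = ((#L w ℕ.≟ p) ×-dec (#R w ℕ.≟ k))
    ×-dec All.all? (λ u → c + #R u ℕ.≤? b (i ∸ #L u)) (inits w)

  ⟦good⟧ : ℕ → ℕ → ℕ → ℕ → List Letter → ℤ
  ⟦good⟧ i c p k w = ⟦ does (good? i c p k w) ⟧

  Good-L : ∀ {i c p k} w → c ≤ b (suc i) → Good (suc i) c (suc p) k (L ∷ w) ⇔ Good i c p k w
  Good-L {i} {c} w c≤b = mk⇔
    (λ { ((#L≡ , #R≡) , _ ∷ bounds) → (ℕ.suc-injective #L≡ , #R≡) , All.map⁻ bounds })
    (λ { ((#L≡ , #R≡) , bounds) → (cong suc #L≡ , #R≡) ,
           subst (_≤ b (suc i)) (sym (ℕ.+-identityʳ c)) c≤b ∷ All.map⁺ bounds })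

  Good-R : ∀ {i c p k} w → c ≤ b i → Good i c p (suc k) (R ∷ w) ⇔ Good i (suc c) p k w
  Good-R {i} {c} w c≤b = mk⇔
    (λ { ((#L≡ , #R≡) , _ ∷ bounds) → (#L≡ , ℕ.suc-injective #R≡) ,
           All.map (λ {u} → subst (_≤ b (i ∸ #L u)) (ℕ.+-suc c (#R u))) (All.map⁻ bounds) })
    (λ { ((#L≡ , #R≡) , bounds) → (#L≡ , cong suc #R≡) ,
           subst (_≤ b i) (sym (ℕ.+-identityʳ c)) c≤b ∷
           All.map⁺ (All.map (λ {u} → subst (_≤ b (i ∸ #L u)) (sym (ℕ.+-suc c (#R u)))) bounds) })

  -- The second entry of the list of prefixes is the single letter R.
  Good-R⇒≤ : ∀ {i c p k} w → Good i c p k (R ∷ w) → suc c ≤ b i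
  Good-R⇒≤ {i} {c} w (_ , _ ∷ bound ∷ _) =
    subst (_≤ b i) (trans (ℕ.+-suc c 0) (cong suc (ℕ.+-identityʳ c))) bound

  -- The superscript in Wᴿ stands for a letter R before the good word, at
  -- position s; the ones in W^L and W^R for the first letter of the good word.
  W Wᴿ W^L W^R : ℕ → ℕ → ℕ → ℕ → ℕ → ℕ → Series-qt
  W   ℓ i c p k s m n = ∑ (words ℓ) λ w → ⟦good⟧ i c p k w ℤ.* weight s w m n
  Wᴿ  ℓ i c p k s m n = ∑ (words ℓ) λ w → ⟦good⟧ i c p k w ℤ.* weight s (R ∷ w) m n
  W^L ℓ i c p k s m n = ∑ (words ℓ) λ w → ⟦good⟧ i c p k (L ∷ w) ℤ.* weight s (L ∷ w) m n
  W^R ℓ i c p k s m n = ∑ (words ℓ) λ w → ⟦good⟧ i c p k (R ∷ w) ℤ.* weight s (R ∷ w) m n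

  W-zero : ∀ {i c} s → c ≤ b i → W 0 i c 0 0 s ≈ₛ 𝟙
  W-zero {i} {c} s c≤b m n = trans (ℤ.+-identityʳ _)
    (trans (cong (λ β → ⟦ β ⟧ ℤ.* 𝟙 m n)
      (dec-true (good? i c 0 0 []) ((refl , refl) , subst (_≤ b i) (sym (ℕ.+-identityʳ c)) c≤b ∷ [])))
    (ℤ.*-identityˡ _))

  W-suc : ∀ ℓ i c p k s → W (suc ℓ) i c p k s ≈ₛ W^L ℓ i c p k s +ₛ W^R ℓ i c p k s
  W-suc ℓ i c p k s m n = ∑-words-suc ℓ λ w → ⟦good⟧ i c p k w ℤ.* weight s w m n

  -- The R at position `s` forms a descent exactly when the next letter is L, and that descent
  -- contributes qˢ t.
  Wᴿ-suc : ∀ ℓ i c p k s →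
    Wᴿ (suc ℓ) i c p k s ≈ₛ T s (W^L ℓ i c p k (suc s)) +ₛ W^R ℓ i c p k (suc s)
  Wᴿ-suc ℓ i c p k s m n = trans
    (∑-words-suc ℓ λ w → ⟦good⟧ i c p k w ℤ.* weight s (R ∷ w) m n)
    (cong (λ z → z ℤ.+ W^R ℓ i c p k (suc s) m n) (trans
      (∑-cong (words ℓ) λ w → cong (ℤ._*_ (⟦good⟧ i c p k (L ∷ w)))
        (T-q^t^ s (sum (descentsFrom (suc s) (L ∷ w))) (length (descentsFrom (suc s) (L ∷ w))) m n))
      (sym (T-∑ s (words ℓ) (λ w → ⟦good⟧ i c p k (L ∷ w)) (λ w → weight (suc s) (L ∷ w)) m n))))

  W^L-suc : ∀ ℓ {i c} p k s → c ≤ b (suc i) → W^L ℓ (suc i) c (suc p) k s ≈ₛ W ℓ i c p k (suc s)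
  W^L-suc ℓ {i} {c} p k s c≤b m n = ∑-cong (words ℓ) λ w → cong (λ β → ⟦ β ⟧ ℤ.* weight (suc s) w m n)
    (does-⇔ (Good-L w c≤b) (good? (suc i) c (suc p) k (L ∷ w)) (good? i c p k w))

  W^R-suc : ∀ ℓ {i c} p k s → c ≤ b i → W^R ℓ i c p (suc k) s ≈ₛ Wᴿ ℓ i (suc c) p k s
  W^R-suc ℓ {i} {c} p k s c≤b m n = ∑-cong (words ℓ) λ w → cong (λ β → ⟦ β ⟧ ℤ.* weight s (R ∷ w) m n)
    (does-⇔ (Good-R w c≤b) (good? i c p (suc k) (R ∷ w)) (good? i (suc c) p k w))

  W^L-zero : ∀ ℓ i c k s m n → W^L ℓ i c 0 k s m n ≡ 0ℤ
  W^L-zero ℓ i c k s m n = ∑-zero (words ℓ)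

  W^R-zero : ∀ ℓ i c p s m n → W^R ℓ i c p 0 s m n ≡ 0ℤ
  W^R-zero ℓ i c p s m n = trans
    (∑-cong (words ℓ) λ w → cong (λ β → ⟦ β ⟧ ℤ.* weight s (R ∷ w) m n)
      (dec-false (good? i c p 0 (R ∷ w)) λ { ((_ , ()) , _) }))
    (∑-zero (words ℓ))

  W^R-bound : ∀ ℓ {i c} p k s → ¬ suc c ≤ b i → ∀ m n → W^R ℓ i c p k s m n ≡ 0ℤ
  W^R-bound ℓ {i} {c} p k s c≮b m n = trans
    (∑-cong (words ℓ) λ w → cong (λ β → ⟦ β ⟧ ℤ.* weight s (R ∷ w) m n)
      (dec-false (good? i c p k (R ∷ w)) (c≮b ∘ Good-R⇒≤ w)))
    (∑-zero (words ℓ))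

-- Chains and words

module _ (b : ℕ → ℕ) (j₀ i₀ c₀ d : ℕ) (es : List (ℕ × ℕ)) (uniq : Unique es)
         (rows   : ∀ {v} → v ∈ es → suc j₀ ≤ proj₁ v)
         (cols   : ∀ {v} → v ∈ es → proj₂ v ≤ d)
         (bounds : ∀ {v} → v ∈ es → proj₂ v ≤ b (proj₁ v))
         (cells  : ∀ {i c} → suc j₀ ≤ i → i ≤ i₀ → c₀ ≤ c → c ≤ d → c ≤ b i → (i , c) ∈ es)
         (b-anti : ∀ {i} → suc j₀ ≤ i → suc i ≤ i₀ → b (suc i) ≤ b i)
         (d≤b    : d ≤ b (suc j₀)) where

  r₀ : ℕ
  r₀ = c₀ ∸ i₀

  ρ : ℕ × ℕ → ℕ
  ρ (i , c) = c ∸ i ∸ r₀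

  open Multichains es ρ (suc j₀)
  open Words b

  -- The chains above (suc i , c) whose least element lies in row suc i.
  X : ℕ → ℕ → Series-qt
  X i c = Z (suc i , c) -ₛ Z (i , c)

  -- `p` and `k` count the letters L and R still to come. `a-rank` makes `a` the relative rank of
  -- the cell, in an additive form that passes easily to the next cell.
  module _ {p k c a : ℕ} (i≤ : suc (p + j₀) ≤ i₀) (c≥ : c₀ ≤ c) (c+k : c + k ≡ d)
           (c≤b : c ≤ b (suc (p + j₀))) (a-rank : a + r₀ + suc (p + j₀) ≡ c) where

    private
      i = p + j₀

    u∈es : (suc i , c) ∈ es
    u∈es = cells (s≤s (ℕ.m≤n+m j₀ p)) i≤ c≥ (ℕ.≤-trans (ℕ.m≤m+n c k) (ℕ.≤-reflexive c+k)) c≤b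

    ρu≡a : ρ (suc i , c) ≡ a
    ρu≡a = trans (cong (λ z → z ∸ suc i ∸ r₀) (sym a-rank))
      (trans (cong (_∸ r₀) (ℕ.m+n∸n≡m (a + r₀) (suc i))) (ℕ.m+n∸n≡m a r₀))

    corner : ∀ m n → Z (suc i , c) m n ℤ.+ Z (i , suc c) m n ≡
      T a (Z (suc i , c)) m n ℤ.+ (Z (i , c) m n ℤ.+ Z (suc i , suc c) m n)
    corner = subst (λ s → ∀ m n → Z (suc i , c) m n ℤ.+ Z (i , suc c) m n ≡
        T s (Z (suc i , c)) m n ℤ.+ (Z (i , c) m n ℤ.+ Z (suc i , suc c) m n)) ρu≡a
      (Z-corner uniq u∈es)

    Z-step : Z (suc i , c) -ₛ T a (Z (suc i , c)) ≈ₛ Z (i , c) +ₛ X i (suc c)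
    Z-step m n = move (Z (suc i , c) m n) (Z (i , suc c) m n) (T a (Z (suc i , c)) m n)
      (Z (i , c) m n) (Z (suc i , suc c) m n) (corner m n)
      where
      move : ∀ u uʳˡ t uˡ uʳ → u ℤ.+ uʳˡ ≡ t ℤ.+ (uˡ ℤ.+ uʳ) → u ℤ.- t ≡ uˡ ℤ.+ (uʳ ℤ.- uʳˡ)
      move u uʳˡ t uˡ uʳ eq = trans (expand u uʳˡ t)
        (trans (cong (λ z → z ℤ.- uʳˡ ℤ.- t) eq) (collect uʳˡ t uˡ uʳ))
        where
        expand : ∀ u uʳˡ t → u ℤ.- t ≡ (u ℤ.+ uʳˡ) ℤ.- uʳˡ ℤ.- t
        expand = solve-∀
        collect : ∀ uʳˡ t uˡ uʳ → t ℤ.+ (uˡ ℤ.+ uʳ) ℤ.- uʳˡ ℤ.- t ≡ uˡ ℤ.+ (uʳ ℤ.- uʳˡ)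
        collect = solve-∀

    -- Subtracting (1 - qᵃ t) Z(i,c) from `Z-step` cancels Z(i,c) and leaves qᵃ t Z(i,c): the weight
    -- of a descent at position `a`.
    X-step : X i c -ₛ T a (X i c) ≈ₛ T a (Z (i , c)) +ₛ X i (suc c)
    X-step m n = trans
      (cong (ℤ._-_ (X i c m n)) (T-sub a (Z (suc i , c)) (Z (i , c)) m n))
      (trans (expand (Z (suc i , c) m n) (Z (i , c) m n)
                     (T a (Z (suc i , c)) m n) (T a (Z (i , c)) m n))
      (trans (cong (λ z → z ℤ.- Z (i , c) m n ℤ.+ T a (Z (i , c)) m n) (Z-step m n))
             (collect (Z (i , c) m n) (X i (suc c) m n) (T a (Z (i , c)) m n))))
      where
      expand : ∀ u uˡ t tˡ → (u ℤ.- uˡ) ℤ.- (t ℤ.- tˡ) ≡ (u ℤ.- t) ℤ.- uˡ ℤ.+ tˡ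
      expand = solve-∀
      collect : ∀ uˡ x tˡ → (uˡ ℤ.+ x) ℤ.- uˡ ℤ.+ tˡ ≡ tˡ ℤ.+ x
      collect = solve-∀

  Z≈0 : ∀ c m n → Z (j₀ , c) m n ≡ 0ℤ
  Z≈0 c = Z-below rows ℕ.≤-refl

  -- Beyond column `d` only the empty chain is left, and row `j₀`, just past the row of the top,
  -- counts nothing. This is the value that ends the recursion at the top.
  X-right : X j₀ (suc d) ≈ₛ 𝟙
  X-right m n = trans
    (cong₂ ℤ._-_ (Z-right (λ v∈ → s≤s (cols v∈)) ℕ.≤-refl m n) (Z≈0 (suc d) m n))
    (ℤ.+-identityʳ (𝟙 m n))

  X≈0 : ∀ {i c} → suc j₀ ≤ i → (∀ {v} → v ∈ es → proj₁ v ≡ suc i → proj₂ v < c) →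
    ∀ m n → X i c m n ≡ 0ℤ
  X≈0 {i} {c} j≤i row m n = trans
    (cong (λ z → z ℤ.- Z (i , c) m n) (Z-skip-row j≤i row m n))
    (ℤ.+-inverseʳ (Z (i , c) m n))

  infix 4 _≈∏[_,_]_
  _≈∏[_,_]_ : Series-qt → ℕ → ℕ → Series-qt → Set
  w ≈∏[ a , ℓ ] f = w ≈ₛ f *ₛ ∏ a ℓ

  ∏-suc : ∀ {g} f a ℓ → f -ₛ T a f ≈ₛ g → g *ₛ ∏ (suc a) ℓ ≈ₛ f *ₛ ∏ a (suc ℓ)
  ∏-suc f a ℓ f-step m n =
    sym (trans (*ₛ-factor a f (∏ (suc a) ℓ) m n) (*ₛ-congʳ (∏ (suc a) ℓ) f-step m n))

  -- A first letter L leads to the first half of the induction hypothesis, a first letter R to the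
  -- second. At relative rank `a` the path has made `a` steps, so the next letter has position
  -- `suc a` and an R just before it has position `a`.
  words-Z : ∀ ℓ p k c a → p + k ≡ ℓ → suc (p + j₀) ≤ i₀ → c₀ ≤ c → c + k ≡ d →
    c ≤ b (suc (p + j₀)) → a + r₀ + suc (p + j₀) ≡ c →
    W  ℓ (suc (p + j₀)) c p k (suc a) ≈∏[ a , suc ℓ ] Z (suc (p + j₀) , c) ×
    Wᴿ ℓ (suc (p + j₀)) c p k a       ≈∏[ a , suc ℓ ] X (p + j₀) c
  words-Z zero zero zero c a _ i≤ c≥ c+k c≤b a-rank =
      (λ m n → trans (base m n) (∏-suc (Z (suc j₀ , c)) a 0 Z-top m n))
    , (λ m n → trans (base m n) (∏-suc (X j₀ c) a 0 X-top m n))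
    where
    X-right′ : X j₀ (suc c) ≈ₛ 𝟙
    X-right′ = subst (λ e → X j₀ (suc e) ≈ₛ 𝟙) (trans (sym c+k) (ℕ.+-identityʳ c)) X-right
    Z-top : Z (suc j₀ , c) -ₛ T a (Z (suc j₀ , c)) ≈ₛ 𝟙
    Z-top m n = trans (Z-step i≤ c≥ c+k c≤b a-rank m n)
      (trans (cong₂ ℤ._+_ (Z≈0 c m n) (X-right′ m n)) (ℤ.+-identityˡ (𝟙 m n)))
    X-top : X j₀ c -ₛ T a (X j₀ c) ≈ₛ 𝟙
    X-top m n = trans (X-step i≤ c≥ c+k c≤b a-rank m n)
      (trans (cong₂ ℤ._+_ (T-zero a (Z≈0 c) m n) (X-right′ m n)) (ℤ.+-identityˡ (𝟙 m n)))
    -- This also covers `Wᴿ`: a final R creates no descent, so both sums unfold to the same one.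
    base : W 0 (suc j₀) c 0 0 (suc a) ≈ₛ 𝟙 *ₛ 𝟙
    base m n = trans (W-zero (suc a) c≤b m n) (sym (*ₛ-identityʳ 𝟙 m n))
  words-Z (suc ℓ) p k c a p+k i≤ c≥ c+k c≤b a-rank =
      (λ m n → trans (W-suc ℓ (suc i) c p k (suc a) m n)
        (trans (cong₂ ℤ._+_ (L-part m n) (R-part m n))
        (trans (sym (*ₛ-distribʳ-+ Π (Z (i , c)) (X i (suc c)) m n))
               (∏-suc (Z (suc i , c)) a (suc ℓ) (Z-step i≤ c≥ c+k c≤b a-rank) m n))))
    , (λ m n → trans (Wᴿ-suc ℓ (suc i) c p k a m n)
        (trans (cong₂ ℤ._+_ (trans (T-cong a L-part m n) (sym (T-*ₛˡ a (Z (i , c)) Π m n)))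
                            (R-part m n))
        (trans (sym (*ₛ-distribʳ-+ Π (T a (Z (i , c))) (X i (suc c)) m n))
               (∏-suc (X i c) a (suc ℓ) (X-step i≤ c≥ c+k c≤b a-rank) m n))))
    where
    i = p + j₀
    Π = ∏ (suc a) (suc ℓ)

    L-part : W^L ℓ (suc i) c p k (suc a) ≈∏[ suc a , suc ℓ ] Z (i , c)
    R-part : W^R ℓ (suc i) c p k (suc a) ≈∏[ suc a , suc ℓ ] X i (suc c)

    -- `p` and `k` are quantified afresh to allow a case split that both halves of the conclusion
    -- share. With no L left the next row is `j₀`, where `Z` vanishes.
    first-L : ∀ p k → p + k ≡ suc ℓ → suc (p + j₀) ≤ i₀ → c + k ≡ d →
      c ≤ b (suc (p + j₀)) → a + r₀ + suc (p + j₀) ≡ c →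
      W^L ℓ (suc (p + j₀)) c p k (suc a) ≈∏[ suc a , suc ℓ ] Z (p + j₀ , c)
    first-L zero    k p+k i≤ c+k c≤b a-rank m n =
      trans (W^L-zero ℓ (suc j₀) c k (suc a) m n) (sym (*ₛ-zeroˡ (Z≈0 c) Π m n))
    first-L (suc p) k p+k i≤ c+k c≤b a-rank m n =
      trans (W^L-suc ℓ p k (suc a) c≤b m n)
        (proj₁ (words-Z ℓ p k c (suc a) (ℕ.suc-injective p+k) (ℕ.≤-trans (ℕ.n≤1+n _) i≤) c≥ c+k
          (ℕ.≤-trans c≤b (b-anti (s≤s (ℕ.m≤n+m j₀ p)) i≤))
          (trans (sym (ℕ.+-suc (a + r₀) (suc (p + j₀)))) a-rank)) m n)

    first-R : ∀ p k → p + k ≡ suc ℓ → suc (p + j₀) ≤ i₀ → c + k ≡ d →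
      c ≤ b (suc (p + j₀)) → a + r₀ + suc (p + j₀) ≡ c →
      W^R ℓ (suc (p + j₀)) c p k (suc a) ≈∏[ suc a , suc ℓ ] X (p + j₀) (suc c)
    -- With no R left `c` equals `d`, so column `suc c` lies beyond all cells. That `p` is positive
    -- comes from `p + k ≡ suc ℓ`.
    first-R (suc p) zero p+k i≤ c+k c≤b a-rank m n =
      trans (W^R-zero ℓ (suc (suc p + j₀)) c (suc p) (suc a) m n)
        (sym (*ₛ-zeroˡ (X≈0 (s≤s (ℕ.m≤n+m j₀ p)) λ v∈ _ →
          s≤s (ℕ.≤-trans (cols v∈) (ℕ.≤-reflexive (trans (sym c+k) (ℕ.+-identityʳ c))))) Π m n))
    first-R p (suc k) p+k i≤ c+k c≤b a-rank m n with suc c ℕ.≤? b (suc (p + j₀))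
    ... | yes c<b = trans (W^R-suc ℓ p k (suc a) c≤b m n)
      (proj₂ (words-Z ℓ p k (suc c) (suc a) (ℕ.suc-injective (trans (sym (ℕ.+-suc p k)) p+k)) i≤
        (ℕ.m≤n⇒m≤1+n c≥) (trans (sym (ℕ.+-suc c k)) c+k) c<b (cong suc a-rank)) m n)
    ... | no c≮b = trans (W^R-bound ℓ p (suc k) (suc a) c≮b m n)
      (sym (*ₛ-zeroˡ (X≈0 (above p c≮b) λ v∈ v≡ →
        s≤s (ℕ.≮⇒≥ λ c<v → c≮b (ℕ.≤-trans c<v (subst (λ r → _ ≤ b r) v≡ (bounds v∈))))) Π m n))
      where
      -- In the row of the top the bound cannot fail, since `suc c ≤ d ≤ b (suc j₀)`. Hence `p` is
      -- positive, and row `p + j₀` still counts the empty chain, as `X≈0` requires.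
      above : ∀ p → ¬ suc c ≤ b (suc (p + j₀)) → suc j₀ ≤ p + j₀
      above zero    c≮b = contradiction
        (ℕ.≤-trans (subst (suc c ≤_) (trans (sym (ℕ.+-suc c k)) c+k) (s≤s (ℕ.m≤m+n c k)))
                   d≤b)
        c≮b
      above (suc p) c≮b = s≤s (ℕ.m≤n+m j₀ p)

    L-part = first-L p k p+k i≤ c+k c≤b a-rank
    R-part = first-R p k p+k i≤ c+k c≤b a-rank

-- Polynomiality and the maximal rank.

∑-monomials-polynomial : (xs : List A) (f g : A → ℕ) →
  IsPolynomial (λ m n → ∑ xs λ x → (q^ f x t^ g x) m n)
∑-monomials-polynomial []       f g = 0 , λ _ _ _ → refl
∑-monomials-polynomial (x ∷ xs) f g with ∑-monomials-polynomial xs f g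
... | N , rest = suc (f x + g x) + N , λ m n large →
  cong₂ ℤ._+_ (head m n large) (rest m n (Sum.map (ℕ.m+n≤o⇒n≤o _) (ℕ.m+n≤o⇒n≤o _) large))
  where
  head : ∀ m n → suc (f x + g x) + N ≤ m ⊎ suc (f x + g x) + N ≤ n → (q^ f x t^ g x) m n ≡ 0ℤ
  head m n (inj₁ N≤m) rewrite dec-false (g x ℕ.≟ m)
    (ℕ.<⇒≢ (ℕ.≤-trans (s≤s (ℕ.m≤n+m (g x) (f x))) (ℕ.m+n≤o⇒m≤o _ N≤m))) = refl
  head m n (inj₂ N≤n) rewrite dec-false (f x ℕ.≟ n)
    (ℕ.<⇒≢ (ℕ.≤-trans (s≤s (ℕ.m≤m+n (f x) (g x))) (ℕ.m+n≤o⇒m≤o _ N≤n))) with g x ≡ᵇ m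
  ... | true  = refl
  ... | false = refl

maxRank≡rank-top : ∀ P → maxRank P ≡ FinGradedPoset.rank P (FinGradedPoset.top P)
maxRank≡rank-top P = ℕ.≤-antisym
  (max≤v⁺ {xs = map rank elements} z≤n (All.map⁺ (All.tabulate λ {z} _ → rank-mono-≤ P (maximum z))))
  (v≤max⁺ 0 (map rank elements) (inj₂ (Any.map⁺ (Any.map (ℕ.≤-reflexive ∘ rank-cong) (complete top)))))
  where open FinGradedPoset P

-- Identifies the maximal rank of the interval with the length of the words.
rank-difference : ∀ {i c j d} → i ≤ c → j ≤ i → c ≤ d → (d ∸ j) ∸ (c ∸ i) ≡ (i ∸ j) + (d ∸ c)
rank-difference {i} {c} {j} {d} i≤c j≤i c≤d = begin
  (d ∸ j) ∸ e           ≡⟨ cong (λ z → z ∸ j ∸ e) d≡ ⟩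
  (p + k + e + j) ∸ j ∸ e ≡⟨ cong (_∸ e) (ℕ.m+n∸n≡m (p + k + e) j) ⟩
  (p + k + e) ∸ e       ≡⟨ ℕ.m+n∸n≡m (p + k) e ⟩
  p + k                 ∎
  where
  open ≡-Reasoning
  e = c ∸ i
  p = i ∸ j
  k = d ∸ c
  rearrange : ∀ p k e j → k + (e + (p + j)) ≡ p + k + e + j
  rearrange = ℕ.solve-∀
  d≡ : d ≡ p + k + e + j
  d≡ = begin
    d                 ≡⟨ ℕ.m∸n+n≡m c≤d ⟨
    k + c             ≡⟨ cong (k +_) (ℕ.m∸n+n≡m i≤c) ⟨
    k + (e + i)       ≡⟨ cong (λ z → k + (e + z)) (ℕ.m∸n+n≡m j≤i) ⟨
    k + (e + (p + j)) ≡⟨ rearrange p k e j ⟩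
    p + k + e + j     ∎

-- Application to an interval of the Ferrers-cell poset.

proposition5p10 : ∀ (r : ℕ) (b : ℕ → ℕ)
    (1≤r : 1 ≤ r)
    (b-anti : ∀ i j → 1 ≤ i → i ≤ j → j ≤ r → b j ≤ b i)
    (b-above : ∀ i → 1 ≤ i → i ≤ r → i ≤ b i)
    (i c j d : ℕ)
    (x∈F : IsCell r b (i , c)) (y∈F : IsCell r b (j , d))
    (x≤y : (i , c) ⊑ (j , d)) →
    IsNumerator
    (interval (ferrersPoset r b 1≤r b-anti b-above)
    {(i , c) , x∈F} {(j , d) , y∈F} x≤y)
    (wordPolynomial b (i , c) (j , d))
-- Rows start at 1, so the row of the top is a successor, and `j₀` indexes the row past it.
proposition5p10 r b 1≤r b-anti b-above i c (suc j₀) d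
  x∈F@((1≤i , i≤r) , i≤c , c≤b) y∈F@((1≤j , j≤r) , j≤d , d≤b) x≤y@(j≤i , c≤d) =
    ∑-monomials-polynomial (boundedWords b (i , c) (j , d)) (sum ∘ descents) (length ∘ descents)
    , product
  where
  j p k h : ℕ
  j = suc j₀
  p = i ∸ j
  k = d ∸ c
  h = p + k

  P : FinGradedPoset
  P = interval (ferrersPoset r b 1≤r b-anti b-above) {(i , c) , x∈F} {(j , d) , y∈F} x≤y
  open FinGradedPoset P using (Carrier; elements; complete; unique)

  κ : Carrier → ℕ × ℕ
  κ z = proj₁ (proj₁ z)

  es : List (ℕ × ℕ)
  es = map κ elements

  ρ′ : ℕ × ℕ → ℕ
  ρ′ (i′ , c′) = c′ ∸ i′ ∸ (c ∸ i)

  uniq : Unique es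
  -- Elements of the interval are equal when their cells are, so uniqueness carries over along `κ`.
  uniq = AllPairs.map⁺ unique

  es-property : {Q : ℕ × ℕ → Set} → (∀ z → Q (κ z)) → ∀ {v} → v ∈ es → Q v
  es-property {Q} q v∈ with ∈-map⁻ κ v∈
  ... | z , _ , refl = q z

  cells∈ : ∀ {i′ c′} → j ≤ i′ → i′ ≤ i → c ≤ c′ → c′ ≤ d → c′ ≤ b i′ → (i′ , c′) ∈ es
  cells∈ {i′} {c′} j≤i′ i′≤i c≤c′ c′≤d c′≤b = Any.map⁺ (complete
    (((i′ , c′) , (ℕ.≤-trans 1≤j j≤i′ , ℕ.≤-trans i′≤i i≤r) ,
        ℕ.≤-trans i′≤i (ℕ.≤-trans i≤c c≤c′) , c′≤b) ,
      (i′≤i , c≤c′) , (j≤i′ , c′≤d)))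

  i≡ : suc (p + j₀) ≡ i
  i≡ = trans (sym (ℕ.+-suc p j₀)) (ℕ.m∸n+n≡m j≤i)

  open Multichains es ρ′ j using (Z)
  open Words b using (W)

  W≈Z∏ : W h i c p k 1 ≈ₛ Z (i , c) *ₛ ∏ 0 (suc h)
  -- The bottom cell has relative rank 0, so the words start at position 1 with all `p + k` letters
  -- to come.
  W≈Z∏ = subst (λ i′ → W h i′ c p k 1 ≈ₛ Z (i′ , c) *ₛ ∏ 0 (suc h)) i≡
    (proj₁ (words-Z b j₀ i c d es uniq
      (es-property λ (_ , _ , j≤ , _) → j≤)
      (es-property λ (_ , _ , _ , ≤d) → ≤d)
      (es-property λ ((_ , _ , _ , ≤b) , _) → ≤b)
      cells∈
      (λ j≤ ≤i → b-anti _ _ (ℕ.≤-trans 1≤j j≤) (ℕ.n≤1+n _) (ℕ.≤-trans ≤i i≤r))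
      d≤b
      h p k c 0 refl (ℕ.≤-reflexive i≡) ℕ.≤-refl (ℕ.m+[n∸m]≡n c≤d)
      (subst (λ i′ → c ≤ b i′) (sym i≡) c≤b)
      (trans (cong (c ∸ i +_) i≡) (ℕ.m∸n+n≡m i≤c))))

  denominator≡ : denominator P ≡ ∏ 0 (suc h)
  denominator≡ = trans (denominator≡∏ P)
    (cong (∏ 0 ∘ suc) (trans (maxRank≡rank-top P) (rank-difference i≤c j≤i c≤d)))

  product : zetaSeries P *ₛ denominator P ≈ₛ wordPolynomial b (i , c) (j , d)
  product m n = begin
    (zetaSeries P *ₛ denominator P) m n
      ≡⟨ cong (λ D → (zetaSeries P *ₛ D) m n) denominator≡ ⟩
    (zetaSeries P *ₛ ∏ 0 (suc h)) m n
      ≡⟨ *ₛ-congʳ (∏ 0 (suc h)) (zetaSeries≈Z P κ ρ′ j (λ _ _ → refl) (λ _ → refl)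
           (λ (_ , _ , j≤ , _) → j≤) j≤i (λ (_ , x≤ , _) → x≤)) m n ⟩
    (Z (i , c) *ₛ ∏ 0 (suc h)) m n
      ≡⟨ W≈Z∏ m n ⟨
    W h i c p k 1 m n
      -- At these indices `good?` unfolds to `isBoundedWord?`.
      ≡⟨ ∑-filter (isBoundedWord? b (i , c) (j , d)) (words h) _ ⟨
    wordPolynomial b (i , c) (j , d) m n ∎
    where open ≡-Reasoning
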